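{- Let $r\ge1$ and let $\mathbf b=(b_1,\dots,b_r)$ be integers with $b_1\ge b_2\ge\cdots\ge b_r$ and $b_i\ge i$ for all $i$. Then the Ferrers-cell poset $F_{\mathbf b}$ with rank $\rho(i,c)=c-i$ satisfies $$\mathbb{H}_{F_{\mathbf b},\rho}(q,t)=\sum_{w\in\mathcal W_{\mathbf b}}q^{\sum_{j\in D(w)}(j-1)}\,t^{|D(w)|}.$$ In particular $\mathbb{H}_{F_{\mathbf b},\rho}(q,t)\in\mathbb{N}[q,t]$. The trapezoidal posets $T_{r,s}=\{(i,c):1\le i\le r,\ i\le c\le s-i\}$ (with $s\ge 2r\ge 2$, the same order and the same rank) are obtained by taking $b_i=s-i$.
   Context: $\mathbb N=\{0,1,2,\dots\}$. $q$-Zeta numerator: let $P$ be a finite graded poset with a unique maximum and rank function $\rho:P\to\{0,\dots,H\}$, where $H$ is the maximal rank. For $m\ge 0$ put $A_m(P,\rho;q)=\sum_{x_1\le\cdots\le x_m}q^{\rho(x_1)+\cdots+\rho(x_m)}$ (sum over weak chains in $P$; $A_0=1$). The numerator $\mathbb{H}_{P,\rho}(q,t)$ is the polynomial determined by $\sum_{m\ge 0}A_m(P,\rho;q)t^m=\mathbb{H}_{P,\rho}(q,t)/\prod_{a=0}^{H}(1-q^at)$. Ferrers-cell poset: $F_{\mathbf b}=\{(i,c):1\le i\le r,\ i\le c\le b_i\}$, ordered by $(i,c)\le(j,d)\iff i\ge j$ and $c\le d$, with rank $\rho(i,c)=c-i$. Words: put $M=b_1-1$. For $w\in\{L,R\}^M$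 let $\ell(w)$ be its number of $L$'s and $\iota(w)=\ell(w)+1$. $\mathcal W_{\mathbf b}$ is the set of words $w\in\{L,R\}^M$ with $\ell(w)\le r-1$ such that for every prefix, with $L_k$ letters $L$ and $R_k$ letters $R$, one has $\iota(w)+R_k\le b_{\iota(w)-L_k}$. For $w=w_1\cdots w_M$, $D(w)=\{j: w_j=L\text{ and }(j=1\text{ or }w_{j-1}=R)\}$. -}

module Defs where

open import Data.Fin using (Fin; toℕ; fromℕ<)
open import Data.Fin.Properties using (toℕ<n; toℕ-injective; toℕ-fromℕ<; any?)
open import Data.Integer as ℤ using (ℤ)
open import Data.List using (List; []; _∷_; map; foldr; upTo; filter; length; tabulate; concat; cartesianProductWith; inits; allFin)
open import Data.List.Extrema.Nat using (max)
open import Data.List.Membership.Propositional using (_∈_)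
open import Data.List.Membership.Propositional.Properties using (∈-concat⁺′; ∈-tabulate⁺; ∈-tabulate⁻)
open import Data.List.Relation.Unary.All as All using (All)
import Data.List.Relation.Unary.All.Properties as Allₚ
import Data.List.Relation.Unary.AllPairs.Properties as AllPairsₚ
open import Data.List.Relation.Unary.Unique.Propositional using (Unique)
import Data.List.Relation.Unary.Unique.Propositional.Properties as Uniqueₚ
open import Data.Nat
open import Data.Nat.ListAction using (sum)
open import Data.Nat.Properties
open import Data.Product using (Σ; ∃-syntax; _×_; _,_)
open import Data.Sum using (_⊎_; inj₁; inj₂)
open import Data.Vec as Vec using (Vec; []; _∷_; lookup; toList)
open import Data.Vec.Relation.Unary.Linked using (Linked; linked?)
open import Function using (_∘_)
open import Function.Bundles using (_↔_; _⇔_; Inverse)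
open import Relation.Binary.Definitions using (DecidableEquality)
open import Relation.Binary.PropositionalEquality
open import Relation.Binary.Structures using (IsDecPartialOrder)
open import Relation.Nullary using (yes; no; contradiction)
open import Relation.Nullary.Decidable using (does; map′; _×-dec_; _⊎-dec_)
open import Relation.Unary using (Decidable)
open import Data.Bool using (if_then_else_)

-- f k m is the integer coefficient of q^k t^m.
Series : Set
Series = ℕ → ℕ → ℤ

infix 4 _≈_
_≈_ : Series → Series → Set
f ≈ g = ∀ k m → f k m ≡ g k m

∑ : ∀ {A : Set} → List A → (A → ℤ) → ℤ
∑ xs f = foldr ℤ._+_ ℤ.0ℤ (map f xs)

δ : ℕ → ℕ → ℤ
δ a k = if does (a ≟ k) then ℤ.1ℤ else ℤ.0ℤ

q^_t^_ : ℕ → ℕ → Series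
(q^ a t^ n) k m = δ a k ℤ.* δ n m

infixl 7 _⊛_
_⊛_ : Series → Series → Series
(f ⊛ g) k m =
  ∑ (upTo (suc k)) λ i → ∑ (upTo (suc m)) λ j → f i j ℤ.* g (k ∸ i) (m ∸ j)

∏ : List Series → Series
∏ = foldr _⊛_ (q^ 0 t^ 0)

1-q^_t : ℕ → Series
(1-q^ a t) k m = (q^ 0 t^ 0) k m ℤ.- (q^ a t^ 1) k m

IsPolynomial : Series → Set
IsPolynomial f = ∃[ N ] (∀ k m → N ≤ k ⊎ N ≤ m → f k m ≡ ℤ.0ℤ)

HasNaturalCoefficients : Series → Set
HasNaturalCoefficients f = ∀ k m → ∃[ n ] f k m ≡ ℤ.+ n

record FiniteGradedPoset : Set₁ where
  infix 4 _⊑_ _⋖_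
  field
    Carrier           : Set
    _⊑_               : Carrier → Carrier → Set
    isDecPartialOrder : IsDecPartialOrder _≡_ _⊑_
    elements          : List Carrier
    complete          : ∀ x → x ∈ elements
    unique            : Unique elements
    top               : Carrier
    top-max           : ∀ x → x ⊑ top
    rank              : Carrier → ℕ

  open IsDecPartialOrder isDecPartialOrder public
    renaming (_≤?_ to _⊑?_) using ()

  _⋖_ : Carrier → Carrier → Set
  x ⋖ y = x ⊑ y × x ≢ y × (∀ z → x ⊑ z → z ⊑ y → z ≡ x ⊎ z ≡ y)

  field
    rank-minimal : ∀ x → (∀ y → y ⊑ x → y ≡ x) → rank x ≡ 0
    rank-cover   : ∀ x y → x ⋖ y → rank y ≡ suc (rank x)

  maxRank : ℕ
  maxRank = max 0 (map rank elements)

vectors : ∀ {A : Set} → List A → ∀ n → List (Vec A n)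
vectors xs zero    = [] ∷ []
vectors xs (suc n) = cartesianProductWith _∷_ xs (vectors xs n)

module _ (P : FiniteGradedPoset) where
  open FiniteGradedPoset P

  weakChains : ∀ m → List (Vec Carrier m)
  weakChains m = filter (linked? _⊑?_) (vectors elements m)

  -- A m k is the coefficient of q^k in A_m(P,ρ;q).
  A : ℕ → ℕ → ℤ
  A m k = ∑ (weakChains m) λ xs → δ (Vec.sum (Vec.map rank xs)) k

  zetaSeries : Series
  zetaSeries k m = A m k

  -- The defining equation Σ A_m t^m = h / ∏ (1 - q^a t), with the
  -- (invertible) denominator cleared.
  IsNumerator : Series → Set
  IsNumerator h =
    IsPolynomial h × h ≈ ∏ (map 1-q^_t (upTo (suc maxRank))) ⊛ zetaSeries

-- A tuple (b₁,…,b_r) is a function on ℕ of which only the values at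
-- 1,…,r are used; entries are natural numbers since b_i ≥ i.
record IsShape (r : ℕ) (b : ℕ → ℕ) : Set where
  field
    r≥1        : 1 ≤ r
    decreasing : ∀ i → 1 ≤ i → i < r → b (suc i) ≤ b i
    diagonal   : ∀ i → 1 ≤ i → i ≤ r → i ≤ b i

FerrersRegion : (r : ℕ) (b : ℕ → ℕ) → ℕ → ℕ → Set
FerrersRegion r b i c = 1 ≤ i × i ≤ r × i ≤ c × c ≤ b i

-- c ≤ s - i is written c + i ≤ s to avoid truncated subtraction.
TrapezoidRegion : (r s : ℕ) → ℕ → ℕ → Set
TrapezoidRegion r s i c = 1 ≤ i × i ≤ r × i ≤ c × c + i ≤ s

record Cell (Region : ℕ → ℕ → Set) : Set where
  constructor cell
  field
    row    : ℕ
    col    : ℕ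
    inside : Region row col

open Cell public

infix 4 _⊑ᶜ_
_⊑ᶜ_ : ∀ {Region} → Cell Region → Cell Region → Set
x ⊑ᶜ y = row x ≥ row y × col x ≤ col y

rankᶜ : ∀ {Region} → Cell Region → ℕ
rankᶜ x = col x ∸ row x

FerrersCell : (r : ℕ) (b : ℕ → ℕ) → Set
FerrersCell r b = Cell (FerrersRegion r b)

-- Preservation of row and column says that both sets of pairs (i,c) are equal.
record SameCells (Region Region′ : ℕ → ℕ → Set) : Set where
  field
    bijection      : Cell Region ↔ Cell Region′
    preserves-row  : ∀ x → row (Inverse.to bijection x) ≡ row x
    preserves-col  : ∀ x → col (Inverse.to bijection x) ≡ col x
    preserves-⊑    : ∀ x y → x ⊑ᶜ y ⇔ Inverse.to bijection x ⊑ᶜ Inverse.to bijection y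
    preserves-rank : ∀ x → rankᶜ (Inverse.to bijection x) ≡ rankᶜ x

module _ {r : ℕ} {b : ℕ → ℕ} where

  cell-≡ : {x y : FerrersCell r b} → row x ≡ row y → col x ≡ col y → x ≡ y
  cell-≡ {cell i c (p₁ , p₂ , p₃ , p₄)} {cell _ _ (q₁ , q₂ , q₃ , q₄)} refl refl
    rewrite ≤-irrelevant p₁ q₁ | ≤-irrelevant p₂ q₂
          | ≤-irrelevant p₃ q₃ | ≤-irrelevant p₄ q₄ = refl

  ⊑ᶜ-isDecPartialOrder : IsDecPartialOrder _≡_ (_⊑ᶜ_ {FerrersRegion r b})
  ⊑ᶜ-isDecPartialOrder = record
    { isPartialOrder = record
      { isPreorder = record
        { isEquivalence = isEquivalence
        ; reflexive     = λ { refl → ≤-refl , ≤-refl }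
        ; trans         = λ (p , q) (p′ , q′) → ≤-trans p′ p , ≤-trans q q′
        }
      ; antisym = λ (p , q) (p′ , q′) → cell-≡ (≤-antisym p′ p) (≤-antisym q q′)
      }
    ; _≟_  = λ x y → map′ (λ (p , q) → cell-≡ p q)
                          (λ { refl → refl , refl })
                          ((row x ≟ row y) ×-dec (col x ≟ col y))
    ; _≤?_ = λ x y → (row y ≤? row x) ×-dec (col x ≤? col y)
    }

  cellAt : (i : Fin r) → Fin (b (suc (toℕ i)) ∸ toℕ i) → FerrersCell r b
  cellAt i k = cell (suc (toℕ i)) (suc (toℕ i) + toℕ k)
    ( s≤s z≤n , toℕ<n i , m≤m+n _ _
    , subst (_≤ b (suc (toℕ i))) (+-comm (suc (toℕ k)) (toℕ i) ∙ +-suc (toℕ i) (toℕ k))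
        (m≤o∸n⇒m+n≤o (suc (toℕ k)) i≤b (toℕ<n k)) )
    where
    _∙_ = trans
    i≤b : toℕ i ≤ b (suc (toℕ i))
    i≤b = <⇒≤ (m∸n≢0⇒n<m λ eq → contradiction (subst (toℕ k <_) eq (toℕ<n k)) n≮0)

  rowCells : Fin r → List (FerrersCell r b)
  rowCells i = tabulate (cellAt i)

  cells : List (FerrersCell r b)
  cells = concat (tabulate rowCells)

  cells-complete : ∀ x → x ∈ cells
  cells-complete (cell (suc i) c (p₁ , i<r , i<c , c≤b)) =
    subst (_∈ cells) (cell-≡ (cong suc eqi) eqc)
      (∈-concat⁺′ (∈-tabulate⁺ k) (∈-tabulate⁺ {f = rowCells} i′))
    where
    i′ = fromℕ< i<r
    eqi : toℕ i′ ≡ i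
    eqi = toℕ-fromℕ< i<r
    bound : c ∸ suc i < b (suc (toℕ i′)) ∸ toℕ i′
    bound rewrite eqi =
      ≤-trans (≤-reflexive (sym (+-∸-assoc 1 i<c))) (∸-monoˡ-≤ i c≤b)
    k = fromℕ< bound
    eqc : suc (toℕ i′) + toℕ k ≡ c
    eqc rewrite toℕ-fromℕ< bound | eqi = m+[n∸m]≡n i<c

  cells-unique : Unique cells
  cells-unique = Uniqueₚ.concat⁺
    (Allₚ.tabulate⁺ λ i → Uniqueₚ.tabulate⁺ λ eq →
      toℕ-injective (+-cancelˡ-≡ (suc (toℕ i)) _ _ (cong col eq)))
    (AllPairsₚ.tabulate⁺ λ {i} {j} i≢j {x} (x∈i , x∈j) →
      i≢j (toℕ-injective (suc-injective
        (trans (sym (row-of i x∈i)) (row-of j x∈j)))))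
    where
    row-of : ∀ i {x} → x ∈ rowCells i → row x ≡ suc (toℕ i)
    row-of i x∈ with ∈-tabulate⁻ x∈
    ... | _ , refl = refl

  module _ (S : IsShape r b) where
    open IsShape S

    antitone : ∀ i → 1 ≤ i → i ≤ r → b i ≤ b 1
    antitone (suc zero)    _ _   = ≤-refl
    antitone (suc (suc i)) _ i≤r = ≤-trans
      (decreasing (suc i) (s≤s z≤n) i≤r)
      (antitone (suc i) (s≤s z≤n) (<⇒≤ i≤r))

    topᶜ : FerrersCell r b
    topᶜ = cell 1 (b 1)
      (≤-refl , r≥1 , diagonal 1 ≤-refl r≥1 , ≤-refl)

    topᶜ-max : ∀ (x : FerrersCell r b) → x ⊑ᶜ topᶜ
    topᶜ-max (cell i c (p₁ , p₂ , p₃ , p₄)) = p₁ , ≤-trans p₄ (antitone i p₁ p₂)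

    rankᶜ-minimal : ∀ (x : FerrersCell r b) → (∀ y → y ⊑ᶜ x → y ≡ x) → rankᶜ x ≡ 0
    rankᶜ-minimal (cell i c (p₁ , p₂ , p₃ , p₄)) min
      rewrite cong col (sym (min (cell i i (p₁ , p₂ , ≤-refl , ≤-trans p₃ p₄)) (≤-refl , p₃)))
      = n∸n≡0 i

    rankᶜ-cover : ∀ (x y : FerrersCell r b) → x ⊑ᶜ y × x ≢ y × (∀ z → x ⊑ᶜ z → z ⊑ᶜ y → z ≡ x ⊎ z ≡ y) →
                  rankᶜ y ≡ suc (rankᶜ x)
    rankᶜ-cover x@(cell i c (p₁ , p₂ , p₃ , p₄)) y@(cell j d (q₁ , q₂ , q₃ , q₄)) ((j≤i , c≤d) , x≢y , cov)
      with m≤n⇒m<n∨m≡n j≤i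
    rankᶜ-cover x@(cell (suc i) c (p₁ , p₂ , p₃ , p₄)) y@(cell (suc j) d (q₁ , q₂ , q₃ , q₄)) ((j≤i , c≤d) , x≢y , cov)
      | inj₁ (s≤s j<i) = result (cov z (n≤1+n i , ≤-refl) (j<i , c≤d))
      where
      1≤i : 1 ≤ i
      1≤i = ≤-trans q₁ j<i
      z : FerrersCell r b
      z = cell i c (1≤i , <⇒≤ p₂ , <⇒≤ p₃ , ≤-trans p₄ (decreasing i 1≤i p₂))
      result : z ≡ x ⊎ z ≡ y → rankᶜ y ≡ suc (rankᶜ x)
      result (inj₁ eq) = contradiction (sym (cong row eq)) 1+n≢n
      result (inj₂ eq) rewrite sym (cong row eq) | sym (cong col eq) = +-∸-assoc 1 p₃
    rankᶜ-cover x@(cell i c (p₁ , p₂ , p₃ , p₄)) y@(cell i d (q₁ , q₂ , q₃ , q₄)) ((j≤i , c≤d) , x≢y , cov)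
      | inj₂ refl with m≤n⇒m<n∨m≡n c≤d
    ... | inj₂ c≡d = contradiction (cell-≡ refl c≡d) x≢y
    ... | inj₁ c<d = result (cov z (≤-refl , n≤1+n c) (≤-refl , c<d))
      where
      z : FerrersCell r b
      z = cell i (suc c) (p₁ , p₂ , ≤-trans p₃ (n≤1+n c) , ≤-trans c<d q₄)
      result : z ≡ x ⊎ z ≡ y → rankᶜ y ≡ suc (rankᶜ x)
      result (inj₁ eq) = contradiction (cong col eq) 1+n≢n
      result (inj₂ eq) rewrite sym (cong col eq) = +-∸-assoc 1 p₃

ferrersPoset : ∀ {r b} → IsShape r b → FiniteGradedPoset
ferrersPoset {r} {b} S = record
  { Carrier           = FerrersCell r b
  ; _⊑_               = _⊑ᶜ_
  ; isDecPartialOrder = ⊑ᶜ-isDecPartialOrder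
  ; elements          = cells
  ; complete          = cells-complete
  ; unique            = cells-unique
  ; top               = topᶜ S
  ; top-max           = topᶜ-max S
  ; rank              = rankᶜ
  ; rank-minimal      = rankᶜ-minimal S
  ; rank-cover        = rankᶜ-cover S
  }

data Letter : Set where
  L R : Letter

_≟ˡ_ : DecidableEquality Letter
L ≟ˡ L = yes refl
L ≟ˡ R = no λ ()
R ≟ˡ L = no λ ()
R ≟ˡ R = yes refl

occurrences : Letter → List Letter → ℕ
occurrences x = length ∘ filter (_≟ˡ x)

Word : ℕ → Set
Word = Vec Letter

ℓ : ∀ {M} → Word M → ℕ
ℓ w = occurrences L (toList w)

ι : ∀ {M} → Word M → ℕ
ι w = suc (ℓ w)

-- Since L_k ≤ ℓ(w) < ι(w) ≤ r, the index ι(w) - L_k lies in 1,…,r.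
PrefixCondition : (b : ℕ → ℕ) → ∀ {M} → Word M → List Letter → Set
PrefixCondition b w u = ι w + occurrences R u ≤ b (ι w ∸ occurrences L u)

InW : (r : ℕ) (b : ℕ → ℕ) → ∀ {M} → Word M → Set
InW r b w = ℓ w ≤ r ∸ 1 × All (PrefixCondition b w) (inits (toList w))

inW? : ∀ r b {M} → Decidable (InW r b {M})
inW? r b w = (ℓ w ≤? r ∸ 1) ×-dec All.all? (λ _ → _ ≤? _) (inits (toList w))

𝒲 : (r : ℕ) (b : ℕ → ℕ) → List (Word (b 1 ∸ 1))
𝒲 r b = filter (inW? r b) (vectors (L ∷ R ∷ []) (b 1 ∸ 1))

-- The Fin index j stands for the position j + 1 of the word, so that
-- toℕ j is "position minus one".
InD : ∀ {M} → Word M → Fin M → Set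
InD {M} w j =
  lookup w j ≡ L ×
  (toℕ j ≡ 0 ⊎ Σ (Fin M) λ i → suc (toℕ i) ≡ toℕ j × lookup w i ≡ R)

inD? : ∀ {M} (w : Word M) → Decidable (InD w)
inD? w j =
  (lookup w j ≟ˡ L) ×-dec
  ((toℕ j ≟ 0) ⊎-dec any? λ i → (suc (toℕ i) ≟ toℕ j) ×-dec (lookup w i ≟ˡ R))

D : ∀ {M} → Word M → List (Fin M)
D {M} w = filter (inD? w) (allFin M)

wordPolynomial : (r : ℕ) (b : ℕ → ℕ) → Series
wordPolynomial r b k m =
  ∑ (𝒲 r b) λ w → (q^ (sum (map toℕ (D w))) t^ (length (D w))) k m

{-# OPTIONS --safe #-}

-- Multiplying by 1 - q^a t is the operator f ↦ f - q^a t f. For an up-set U let Z(U) be the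
-- generating function of the weak chains inside U. Chains in U whose least element is x, the
-- minimum of U, contribute q^ρ(x) t Z(U), so (1 - q^ρ(x) t) Z(↑x) = Z(↑x ∖ {x}); and
-- Z(U ∪ V) + Z(U ∩ V) = Z(U) + Z(V), since a chain lies in whichever up-set contains its least
-- element. With Z(i,c) the series of the up-set of cells with row ≤ i and column ≥ c, a cell
-- (i,c) of rank h thus satisfies
--   (1 - q^h t) Z(i,c) + Z(i-1,c+1) = Z(i-1,c) + Z(i,c+1).
-- A word of 𝒲 is a saturated chain from a minimal cell (i,i) up to the top, L decreasing the row
-- and R increasing the column. Removing the first letter gives, for the words that start at
-- (i,c), the recursion satisfied by Z(i,c) (1 - q^h t) ⋯ (1 - q^H t); a letter L is charged
-- exactly when the preceding letter is R, which accounts for the correction term Z(i-1,c+1).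
-- The minimal cells are collected by the same inclusion–exclusion on the number of rows.

module Submission where

open import Defs
open import Algebra.Bundles using (AbelianGroup)
open import Algebra.Properties.Group using (∙-cancelʳ)
open import Data.Bool using (if_then_else_; true; false)
open import Data.Fin as Fin using (Fin; toℕ)
open import Data.Fin.Properties using (any?)
open import Data.Integer as ℤ using (ℤ; 0ℤ; 1ℤ) renaming (_+_ to _+ᶻ_; _-_ to _-ᶻ_; _*_ to _*ᶻ_)
import Data.Integer.Properties as ℤₚ
open import Data.Integer.Tactic.RingSolver using (solve-∀)
open import Data.List using (List; []; _∷_; _++_; map; filter; length; tabulate; allFin; inits; applyUpTo; upTo; cartesianProductWith)
open import Data.List.Extrema.Nat using (max≤v⁺; v≤max⁺)
open import Data.List.Membership.Propositional using (_∈_)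
open import Data.List.Membership.Propositional.Properties using (∈-map⁺)
open import Data.List.Properties using (map-upTo; map-∘; map-cong; map-tabulate; filter-≐)
open import Data.List.Relation.Unary.All as All using (All; []; _∷_)
import Data.List.Relation.Unary.All.Properties as Allₚ
open import Data.List.Relation.Unary.AllPairs using (_∷_)
open import Data.List.Relation.Unary.Any as Any using (here; there)
open import Data.List.Relation.Unary.Unique.Propositional using (Unique)
open import Data.Nat
open import Data.Nat.ListAction using (sum)
open import Data.Nat.Properties
open import Data.Product as Product using (_×_; _,_; proj₁; proj₂; Σ)
open import Data.Sum as Sum using (_⊎_; inj₁; inj₂)
open import Data.Vec as Vec using (Vec; []; _∷_; toList; lookup)
open import Data.Vec.Relation.Unary.All as VAll using ([]; _∷_)
open import Data.Vec.Relation.Unary.Linked using (Linked; []; [-]; _∷_; linked?)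
open import Function using (_∘_; id)
open import Function.Bundles using (_⇔_; mk⇔; mk↔ₛ′; Equivalence)
open import Level using (0ℓ)
open import Relation.Binary.PropositionalEquality
open import Relation.Binary.Structures using (IsDecPartialOrder)
open import Relation.Nullary using (Dec; yes; no; does; ¬_; contradiction)
open import Relation.Nullary.Decidable using (_×-dec_; _⊎-dec_; ¬?; dec-false; does-⇔)
open import Relation.Unary using (Pred; Decidable)

private variable
  X Y : Set

-- Finite sums

∑-cong : ∀ (xs : List X) {f g : X → ℤ} → (∀ x → f x ≡ g x) → ∑ xs f ≡ ∑ xs g
∑-cong []       f≗g = refl
∑-cong (x ∷ xs) f≗g = cong₂ _+ᶻ_ (f≗g x) (∑-cong xs f≗g)

∑-zero : ∀ (xs : List X) {f : X → ℤ} → (∀ x → f x ≡ 0ℤ) → ∑ xs f ≡ 0ℤ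
∑-zero []       f≗0 = refl
∑-zero (x ∷ xs) f≗0 = cong₂ _+ᶻ_ (f≗0 x) (∑-zero xs f≗0)

interchange : ∀ a b c d → (a +ᶻ b) +ᶻ (c +ᶻ d) ≡ (a +ᶻ c) +ᶻ (b +ᶻ d)
interchange = solve-∀

∑-+ : ∀ (xs : List X) (f g : X → ℤ) →
      ∑ xs (λ x → f x +ᶻ g x) ≡ ∑ xs f +ᶻ ∑ xs g
∑-+ []       f g = refl
∑-+ (x ∷ xs) f g = trans (cong ((f x +ᶻ g x) +ᶻ_) (∑-+ xs f g))
                         (interchange (f x) (g x) (∑ xs f) (∑ xs g))

∑-map : ∀ (h : X → Y) xs (f : Y → ℤ) → ∑ (map h xs) f ≡ ∑ xs (f ∘ h)
∑-map h []       f = refl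
∑-map h (x ∷ xs) f = cong (f (h x) +ᶻ_) (∑-map h xs f)

∑-++ : ∀ (xs ys : List X) (f : X → ℤ) → ∑ (xs ++ ys) f ≡ ∑ xs f +ᶻ ∑ ys f
∑-++ []       ys f = sym (ℤₚ.+-identityˡ _)
∑-++ (x ∷ xs) ys f = trans (cong (f x +ᶻ_) (∑-++ xs ys f))
                           (sym (ℤₚ.+-assoc (f x) (∑ xs f) (∑ ys f)))

∑-upTo : ∀ n (f : ℕ → ℤ) → ∑ (upTo (suc n)) f ≡ f 0 +ᶻ ∑ (upTo n) (f ∘ suc)
∑-upTo n f = cong (f 0 +ᶻ_)
  (trans (cong (λ xs → ∑ xs f) (sym (map-upTo suc n))) (∑-map suc (upTo n) f))

∑-vectors : ∀ (xs : List X) n (f : Vec X (suc n) → ℤ) →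
            ∑ (vectors xs (suc n)) f ≡ ∑ xs (λ x → ∑ (vectors xs n) (λ v → f (x ∷ v)))
∑-vectors xs n f = go xs
  where
  go : ∀ ys → ∑ (cartesianProductWith _∷_ ys (vectors xs n)) f ≡
              ∑ ys (λ y → ∑ (vectors xs n) (λ v → f (y ∷ v)))
  go []       = refl
  go (y ∷ ys) = trans (∑-++ (map (y ∷_) (vectors xs n)) _ f)
                      (cong₂ _+ᶻ_ (∑-map (y ∷_) (vectors xs n) f) (go ys))

𝟙 : ∀ {A : Set} → Dec A → ℤ
𝟙 d = if does d then 1ℤ else 0ℤ

𝟙-cong : ∀ {A B : Set} (d : Dec A) (e : Dec B) → A ⇔ B → 𝟙 d ≡ 𝟙 e
𝟙-cong d e A⇔B = cong (if_then 1ℤ else 0ℤ) (does-⇔ A⇔B d e)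

-- Inclusion-exclusion for indicators. It underlies the four-term identity for up-sets and, through
-- `𝟙-⊎`, disjoint case splits.
𝟙-⊎-× : ∀ {A B : Set} (d : Dec A) (e : Dec B) →
        𝟙 (d ⊎-dec e) +ᶻ 𝟙 (d ×-dec e) ≡ 𝟙 d +ᶻ 𝟙 e
𝟙-⊎-× (yes _) (yes _) = refl
𝟙-⊎-× (yes _) (no  _) = refl
𝟙-⊎-× (no  _) (yes _) = refl
𝟙-⊎-× (no  _) (no  _) = refl

𝟙-× : ∀ {A B : Set} (d : Dec A) (e : Dec B) → 𝟙 (d ×-dec e) ≡ 𝟙 d *ᶻ 𝟙 e
𝟙-× (yes _) e = sym (ℤₚ.*-identityˡ (𝟙 e))
𝟙-× (no  _) e = refl

𝟙-yes : ∀ {A : Set} (d : Dec A) → A → 𝟙 d ≡ 1ℤ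
𝟙-yes d a = 𝟙-cong d (yes a) (mk⇔ id id)

𝟙-no : ∀ {A : Set} (d : Dec A) → ¬ A → 𝟙 d ≡ 0ℤ
𝟙-no d ¬a = 𝟙-cong d (no ¬a) (mk⇔ id id)

𝟙-⊎ : ∀ {A B C : Set} (d : Dec A) (e : Dec B) (u : Dec C) → C ⇔ (A ⊎ B) → ¬ (A × B) →
      𝟙 u ≡ 𝟙 d +ᶻ 𝟙 e
𝟙-⊎ d e u C⇔A⊎B disjoint = trans (𝟙-cong u (d ⊎-dec e) C⇔A⊎B)
  (trans (trans (sym (ℤₚ.+-identityʳ _))
                (cong (𝟙 (d ⊎-dec e) +ᶻ_) (sym (𝟙-no (d ×-dec e) disjoint))))
         (𝟙-⊎-× d e))

∑-filter : ∀ {P : Pred X 0ℓ} (P? : Decidable P) xs (f : X → ℤ) →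
           ∑ (filter P? xs) f ≡ ∑ xs (λ x → 𝟙 (P? x) *ᶻ f x)
∑-filter P? []       f = refl
∑-filter P? (x ∷ xs) f with P? x
... | yes _ = cong₂ _+ᶻ_ (sym (ℤₚ.*-identityˡ (f x))) (∑-filter P? xs f)
... | no  _ = trans (∑-filter P? xs f) (sym (ℤₚ.+-identityˡ _))

-- Uniqueness of the enumeration ensures that the surviving term is counted once. It isolates the
-- chains with a prescribed first element.
∑-single : ∀ {xs : List X} {x} → Unique xs → x ∈ xs → (f : X → ℤ) →
           (∀ y → y ≢ x → f y ≡ 0ℤ) → ∑ xs f ≡ f x
∑-single {xs = x ∷ xs} (x∉xs ∷ _) (here refl) f f≡0 =
  trans (cong (f x +ᶻ_) (zeros x∉xs)) (ℤₚ.+-identityʳ (f x))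
  where
  zeros : ∀ {ys} → All (x ≢_) ys → ∑ ys f ≡ 0ℤ
  zeros []            = refl
  zeros (x≢y ∷ x∉ys) = cong₂ _+ᶻ_ (f≡0 _ (x≢y ∘ sym)) (zeros x∉ys)
∑-single {xs = y ∷ xs} (y∉xs ∷ u) (there x∈xs) f f≡0 =
  trans (cong₂ _+ᶻ_ (f≡0 y (All.lookup y∉xs x∈xs)) (∑-single u x∈xs f f≡0)) (ℤₚ.+-identityˡ _)

-- Multiplication by 1 - q^a t

≈-refl : ∀ {f} → f ≈ f
≈-refl k m = refl

≈-sym : ∀ {f g} → f ≈ g → g ≈ f
≈-sym f≈g k m = sym (f≈g k m)

≈-trans : ∀ {f g h} → f ≈ g → g ≈ h → f ≈ h
≈-trans f≈g g≈h k m = trans (f≈g k m) (g≈h k m)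

infixl 6 _⊕_
_⊕_ : Series → Series → Series
(f ⊕ g) k m = f k m +ᶻ g k m

⊕-cong : ∀ {f f′ g g′} → f ≈ f′ → g ≈ g′ → f ⊕ g ≈ f′ ⊕ g′
⊕-cong p q k m = cong₂ _+ᶻ_ (p k m) (q k m)

-- The recursions carry a correction term; they are compared by adding it to both sides and
-- cancelling it afterwards.
⊕-cancelʳ : ∀ {f g} h → f ⊕ h ≈ g ⊕ h → f ≈ g
⊕-cancelʳ {f} {g} h eq k m = ∙-cancelʳ (AbelianGroup.group ℤₚ.+-0-abelianGroup) (h k m) (f k m) (g k m) (eq k m)

-- Multiplication by q^a at a fixed power of t. Recursion on `a` pads with zeros and avoids
-- truncated subtraction in the exponent.
qshift : ℕ → (ℕ → ℤ) → ℕ → ℤ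
qshift zero    f k       = f k
qshift (suc a) f zero    = 0ℤ
qshift (suc a) f (suc k) = qshift a f k

qshift-cong : ∀ a {f g} → (∀ k → f k ≡ g k) → ∀ k → qshift a f k ≡ qshift a g k
qshift-cong zero    f≗g k       = f≗g k
qshift-cong (suc a) f≗g zero    = refl
qshift-cong (suc a) f≗g (suc k) = qshift-cong a f≗g k

-- One induction serves sums, differences and scalar multiples; the hypothesis `0ℤ ∙ 0ℤ ≡ 0ℤ`
-- handles the padded coefficients.
qshift-zipWith : ∀ (_∙_ : ℤ → ℤ → ℤ) → 0ℤ ∙ 0ℤ ≡ 0ℤ → ∀ a f g k →
                 qshift a (λ k → f k ∙ g k) k ≡ qshift a f k ∙ qshift a g k
qshift-zipWith _∙_ eq zero    f g k       = refl
qshift-zipWith _∙_ eq (suc a) f g zero    = sym eq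
qshift-zipWith _∙_ eq (suc a) f g (suc k) = qshift-zipWith _∙_ eq a f g k

qshift-zero : ∀ a k → qshift a (λ _ → 0ℤ) k ≡ 0ℤ
qshift-zero zero    k       = refl
qshift-zero (suc a) zero    = refl
qshift-zero (suc a) (suc k) = qshift-zero a k

qshift-+ : ∀ a b f k → qshift a (qshift b f) k ≡ qshift (a + b) f k
qshift-+ zero    b f k       = refl
qshift-+ (suc a) b f zero    = refl
qshift-+ (suc a) b f (suc k) = qshift-+ a b f k

qshift-comm : ∀ a b f k → qshift a (qshift b f) k ≡ qshift b (qshift a f) k
qshift-comm a b f k = trans (qshift-+ a b f k)
  (trans (cong (λ n → qshift n f k) (+-comm a b)) (sym (qshift-+ b a f k)))

qshift-∑ : ∀ a (xs : List X) (f : X → ℕ → ℤ) k →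
           qshift a (λ k → ∑ xs (λ x → f x k)) k ≡ ∑ xs (λ x → qshift a (f x) k)
qshift-∑ a []       f k = qshift-zero a k
qshift-∑ a (x ∷ xs) f k = trans (qshift-zipWith _+ᶻ_ refl a (f x) _ k)
  (cong (qshift a (f x) k +ᶻ_) (qshift-∑ a xs f k))

qshift-*ˡ : ∀ a c f k → qshift a (λ k → c *ᶻ f k) k ≡ c *ᶻ qshift a f k
qshift-*ˡ a c f k = qshift-zipWith (λ _ y → c *ᶻ y) (ℤₚ.*-zeroʳ c) a f f k

qshift-δ : ∀ a s k → qshift a (δ s) k ≡ δ (a + s) k
qshift-δ zero    s k       = refl
qshift-δ (suc a) s zero    = refl
qshift-δ (suc a) s (suc k) = qshift-δ a s k

-- Multiplication by q^a t.
shift : ℕ → Series → Series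
shift a f k zero    = 0ℤ
shift a f k (suc m) = qshift a (λ k → f k m) k

shift-cong : ∀ a {f g} → f ≈ g → shift a f ≈ shift a g
shift-cong a f≈g k zero    = refl
shift-cong a f≈g k (suc m) = qshift-cong a (λ k → f≈g k m) k

shift-zipWith : ∀ (_∙_ : ℤ → ℤ → ℤ) → 0ℤ ∙ 0ℤ ≡ 0ℤ → ∀ a f g →
                shift a (λ k m → f k m ∙ g k m) ≈ (λ k m → shift a f k m ∙ shift a g k m)
shift-zipWith _∙_ eq a f g k zero    = sym eq
shift-zipWith _∙_ eq a f g k (suc m) = qshift-zipWith _∙_ eq a _ _ k

shift-∑ : ∀ a (xs : List X) (c : X → ℤ) (f : X → Series) →
          shift a (λ k m → ∑ xs (λ x → c x *ᶻ f x k m)) ≈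
          (λ k m → ∑ xs (λ x → c x *ᶻ shift a (f x) k m))
shift-∑ a xs c f k zero    = sym (∑-zero xs λ x → ℤₚ.*-zeroʳ (c x))
shift-∑ a xs c f k (suc m) = trans (qshift-∑ a xs (λ x k → c x *ᶻ f x k m) k)
  (∑-cong xs λ x → qshift-*ˡ a (c x) (λ k → f x k m) k)

shift-comm : ∀ a b f → shift a (shift b f) ≈ shift b (shift a f)
shift-comm a b f k zero          = refl
shift-comm a b f k (suc zero)    = trans (qshift-zero a k) (sym (qshift-zero b k))
shift-comm a b f k (suc (suc m)) = qshift-comm a b (λ k → f k m) k

factor : ℕ → Series → Series
factor a f k m = f k m -ᶻ shift a f k m

factor-cong : ∀ a {f g} → f ≈ g → factor a f ≈ factor a g
factor-cong a f≈g k m = cong₂ _-ᶻ_ (f≈g k m) (shift-cong a f≈g k m)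

+-−-interchange : ∀ a b c d → (a +ᶻ b) -ᶻ (c +ᶻ d) ≡ (a -ᶻ c) +ᶻ (b -ᶻ d)
+-−-interchange = solve-∀

factor-⊕ : ∀ a f g → factor a (f ⊕ g) ≈ factor a f ⊕ factor a g
factor-⊕ a f g k m = trans
  (cong ((f k m +ᶻ g k m) -ᶻ_) (shift-zipWith _+ᶻ_ refl a f g k m))
  (+-−-interchange (f k m) (g k m) _ _)

−-−-interchange : ∀ a b c d → (a -ᶻ b) -ᶻ (c -ᶻ d) ≡ (a -ᶻ c) -ᶻ (b -ᶻ d)
−-−-interchange = solve-∀

factor-comm : ∀ a b f → factor a (factor b f) ≈ factor b (factor a f)
factor-comm a b f k m = trans
  (cong ((f k m -ᶻ shift b f k m) -ᶻ_) (shift-zipWith _-ᶻ_ refl a f _ k m))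
  (trans (−-−-interchange (f k m) (shift b f k m) (shift a f k m) _)
    (cong (λ z → (f k m -ᶻ shift a f k m) -ᶻ z)
      (trans (cong (shift b f k m -ᶻ_) (shift-comm a b f k m))
             (sym (shift-zipWith _-ᶻ_ refl b f _ k m)))))

−-+-cancel : ∀ a b → (a -ᶻ b) +ᶻ b ≡ a
−-+-cancel = solve-∀

factor-⊕-shift : ∀ a f → factor a f ⊕ shift a f ≈ f
factor-⊕-shift a f k m = −-+-cancel (f k m) (shift a f k m)

-- factors h n f is f multiplied by (1 - q^h t) ⋯ (1 - q^(h+n-1) t).
factors : ℕ → ℕ → Series → Series
factors h zero    f = f
factors h (suc n) f = factor h (factors (suc h) n f)

factors-cong : ∀ h n {f g} → f ≈ g → factors h n f ≈ factors h n g
factors-cong h zero    f≈g = f≈g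
factors-cong h (suc n) f≈g = factor-cong h (factors-cong (suc h) n f≈g)

factors-⊕ : ∀ h n f g → factors h n (f ⊕ g) ≈ factors h n f ⊕ factors h n g
factors-⊕ h zero    f g = ≈-refl
factors-⊕ h (suc n) f g =
  ≈-trans (factor-cong h (factors-⊕ (suc h) n f g))
          (factor-⊕ h (factors (suc h) n f) (factors (suc h) n g))

-- Operators `factor` commute, so any one of them can be moved innermost, where it acts directly on
-- a chain series.
factors-factor : ∀ a h n f → factors h n (factor a f) ≈ factor a (factors h n f)
factors-factor a h zero    f = ≈-refl
factors-factor a h (suc n) f =
  ≈-trans (factor-cong h (factors-factor a (suc h) n f)) (factor-comm h a (factors (suc h) n f))

factors-⊕-cong : ∀ h n {f g f′ g′} → f ⊕ g ≈ f′ ⊕ g′ →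
                 factors h n f ⊕ factors h n g ≈ factors h n f′ ⊕ factors h n g′
factors-⊕-cong h n {f} {g} {f′} {g′} eq = ≈-trans (≈-sym (factors-⊕ h n f g))
  (≈-trans (factors-cong h n eq) (factors-⊕ h n f′ g′))

-- Convolution, and the denominator as an operator

⊛-cong : ∀ {f f′ g g′} → f ≈ f′ → g ≈ g′ → f ⊛ g ≈ f′ ⊛ g′
⊛-cong p q k m = ∑-cong (upTo (suc k)) λ i → ∑-cong (upTo (suc m)) λ j →
  cong₂ _*ᶻ_ (p i j) (q (k ∸ i) (m ∸ j))

⊛-distribʳ-⊕ : ∀ h f g → (f ⊕ g) ⊛ h ≈ f ⊛ h ⊕ g ⊛ h
⊛-distribʳ-⊕ h f g k m = trans
  (∑-cong (upTo (suc k)) λ i → trans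
    (∑-cong (upTo (suc m)) λ j → ℤₚ.*-distribʳ-+ (h (k ∸ i) (m ∸ j)) (f i j) (g i j))
    (∑-+ (upTo (suc m)) (term f i) (term g i)))
  (∑-+ (upTo (suc k)) (λ i → ∑ (upTo (suc m)) (term f i)) (λ i → ∑ (upTo (suc m)) (term g i)))
  where
  term : Series → ℕ → ℕ → ℤ
  term e i j = e i j *ᶻ h (k ∸ i) (m ∸ j)

-- Each unit of `a` kills the term `i = 0` and shifts the others down by one. The inner sum over
-- `js` is left abstract, since only the exponent of q moves.
qshift-⊛ : ∀ a (js : List X) (g h : ℕ → X → ℤ) k →
  ∑ (upTo (suc k)) (λ i → ∑ js (λ j → qshift a (λ i → g i j) i *ᶻ h (k ∸ i) j)) ≡
  qshift a (λ k → ∑ (upTo (suc k)) (λ i → ∑ js (λ j → g i j *ᶻ h (k ∸ i) j))) k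
qshift-⊛ zero    js g h k       = refl
qshift-⊛ (suc a) js g h zero    = cong (_+ᶻ 0ℤ) (∑-zero js λ j → refl)
qshift-⊛ (suc a) js g h (suc k) = trans (∑-upTo (suc k) outer)
  (trans (cong₂ _+ᶻ_ (∑-zero js λ j → refl) (qshift-⊛ a js g h k)) (ℤₚ.+-identityˡ _))
  where
  outer : ℕ → ℤ
  outer i = ∑ js (λ j → qshift (suc a) (λ i → g i j) i *ᶻ h (suc k ∸ i) j)

shift-⊛ : ∀ a f g → shift a f ⊛ g ≈ shift a (f ⊛ g)
shift-⊛ a f g k zero    = ∑-zero (upTo (suc k)) λ i → refl
shift-⊛ a f g k (suc m) = trans (∑-cong (upTo (suc k)) drop-first)
  (qshift-⊛ a (upTo (suc m)) f (λ l j → g l (m ∸ j)) k)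
  where
  term : ℕ → ℕ → ℤ
  term i j = shift a f i j *ᶻ g (k ∸ i) (suc m ∸ j)
  drop-first : ∀ i → ∑ (upTo (suc (suc m))) (term i) ≡ ∑ (upTo (suc m)) (term i ∘ suc)
  drop-first i = trans (∑-upTo (suc m) (term i)) (ℤₚ.+-identityˡ _)

⊛-identityˡ : ∀ g → q^ 0 t^ 0 ⊛ g ≈ g
⊛-identityˡ g k m = trans (∑-upTo k outer) (trans (cong₂ _+ᶻ_
    (trans (∑-upTo m inner) (cong₂ _+ᶻ_ (ℤₚ.*-identityˡ (g k m)) (∑-zero (upTo m) λ j → refl)))
    (∑-zero (upTo k) λ i → ∑-zero (upTo (suc m)) λ j → refl))
  (trans (ℤₚ.+-identityʳ _) (ℤₚ.+-identityʳ _)))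
  where
  inner outer : ℕ → ℤ
  inner j = (q^ 0 t^ 0) 0 j *ᶻ g k (m ∸ j)
  outer i = ∑ (upTo (suc m)) (λ j → (q^ 0 t^ 0) i j *ᶻ g (k ∸ i) (m ∸ j))

q^t^-shift : ∀ a s n → q^ (a + s) t^ (suc n) ≈ shift a (q^ s t^ n)
q^t^-shift a s n k zero    = ℤₚ.*-zeroʳ (δ (a + s) k)
q^t^-shift a s n k (suc m) = trans (cong (_*ᶻ δ n m) (sym (qshift-δ a s k)))
  (trans (ℤₚ.*-comm _ (δ n m))
    (trans (sym (qshift-*ˡ a (δ n m) (δ s) k))
      (qshift-cong a (λ k → ℤₚ.*-comm (δ n m) (δ s k)) k)))

-- After `shift a (f ⊛ g)` is added, both sides become `f ⊛ g`, by distributivity and `shift-⊛`.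
factor-⊛ : ∀ a f g → factor a f ⊛ g ≈ factor a (f ⊛ g)
factor-⊛ a f g = ⊕-cancelʳ (shift a (f ⊛ g)) (≈-trans
  (⊕-cong (≈-refl {factor a f ⊛ g}) (≈-sym (shift-⊛ a f g)))
  (≈-trans (≈-sym (⊛-distribʳ-⊕ g (factor a f) (shift a f)))
    (≈-trans (⊛-cong (factor-⊕-shift a f) (≈-refl {g})) (≈-sym (factor-⊕-shift a (f ⊛ g))))))

1-q^t-⊛ : ∀ a g → 1-q^ a t ⊛ g ≈ factor a g
1-q^t-⊛ a g = ≈-trans (⊛-cong 1-q^t≈ (≈-refl {g}))
  (≈-trans (factor-⊛ a (q^ 0 t^ 0) g) (factor-cong a (⊛-identityˡ g)))
  where
  1-q^t≈ : 1-q^ a t ≈ factor a (q^ 0 t^ 0)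
  1-q^t≈ k m = cong ((q^ 0 t^ 0) k m -ᶻ_)
    (trans (cong (λ b → (q^ b t^ 1) k m) (sym (+-identityʳ a))) (q^t^-shift a 0 0 k m))

-- Each linear factor acts as `factor`, which passes through `⊛`, so the product unwinds into
-- iterated operators. A general enumeration `e` lets the induction continue with `e ∘ suc`.
∏-⊛ : ∀ h n (e : ℕ → ℕ) → (∀ i → e i ≡ h + i) → ∀ g →
      ∏ (map 1-q^_t (applyUpTo e n)) ⊛ g ≈ factors h n g
∏-⊛ h zero    e e≡ g = ⊛-identityˡ g
∏-⊛ h (suc n) e e≡ g rewrite e≡ 0 | +-identityʳ h =
  ≈-trans (⊛-cong (1-q^t-⊛ h p) (≈-refl {g}))
    (≈-trans (factor-⊛ h p g)
      (factor-cong h (∏-⊛ (suc h) n (e ∘ suc) (λ i → trans (e≡ (suc i)) (+-suc h i)) g)))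
  where p = ∏ (map 1-q^_t (applyUpTo (e ∘ suc) n))

-- Weak chains inside an up-set

module ChainSums (P : FiniteGradedPoset) where
  open FiniteGradedPoset P
  private module ≤P = IsDecPartialOrder isDecPartialOrder

  private variable
    Q Q′ : Pred Carrier 0ℓ
    m : ℕ

  Chain : Pred Carrier 0ℓ → Vec Carrier m → Set
  Chain Q xs = Linked _⊑_ xs × VAll.All Q xs

  chain? : Decidable Q → (xs : Vec Carrier m) → Dec (Chain Q xs)
  chain? Q? xs = linked? _⊑?_ xs ×-dec VAll.all? Q? xs

  rankSum : Vec Carrier m → ℕ
  rankSum xs = Vec.sum (Vec.map rank xs)

  chainSum : Decidable Q → Series
  chainSum Q? k m = ∑ (vectors elements m) λ xs → 𝟙 (chain? Q? xs) *ᶻ δ (rankSum xs) k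

  chainSum-cong : (Q? : Decidable Q) (Q′? : Decidable Q′) → (∀ x → Q x ⇔ Q′ x) →
                  chainSum Q? ≈ chainSum Q′?
  chainSum-cong Q? Q′? Q⇔Q′ k m = ∑-cong (vectors elements m) λ xs →
    cong (_*ᶻ δ (rankSum xs) k) (𝟙-cong (chain? Q? xs) (chain? Q′? xs)
      (mk⇔ (Product.map₂ (VAll.map (Equivalence.to (Q⇔Q′ _))))
           (Product.map₂ (VAll.map (Equivalence.from (Q⇔Q′ _))))))

  -- Only the empty chain is left, and it contributes 1.
  chainSum-∅ : (Q? : Decidable Q) → (∀ x → ¬ Q x) → chainSum Q? ≈ q^ 0 t^ 0
  chainSum-∅ Q? ¬Q k zero    = trans (ℤₚ.+-identityʳ _) (ℤₚ.*-comm 1ℤ (δ 0 k))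
  chainSum-∅ Q? ¬Q k (suc m) = trans (∑-vectors elements m _)
    (trans (∑-zero elements λ x → ∑-zero (vectors elements m) λ xs →
             cong (_*ᶻ δ (rankSum (x ∷ xs)) k)
               (𝟙-no (chain? Q? (x ∷ xs)) λ { (_ , q ∷ _) → ¬Q x q }))
           (sym (ℤₚ.*-zeroʳ (δ 0 k))))

  chainSum-full : (Q? : Decidable Q) → (∀ x → Q x) → zetaSeries P ≈ chainSum Q?
  chainSum-full Q? all k m = trans
    (∑-filter (linked? _⊑?_) (vectors elements m) (λ xs → δ (rankSum xs) k))
    (∑-cong (vectors elements m) λ xs → cong (_*ᶻ δ (rankSum xs) k)
      (𝟙-cong (linked? _⊑?_ xs) (chain? Q? xs)
        (mk⇔ (_, VAll.universal all xs) proj₁)))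

  UpSet : Pred Carrier 0ℓ → Set
  UpSet Q = ∀ x y → x ⊑ y → Q x → Q y

  -- Up-closedness carries membership along each link, which is why the least element of a chain
  -- decides everything.
  head⇒all : ∀ {x} {xs : Vec Carrier m} → UpSet Q → Linked _⊑_ (x ∷ xs) → Q x → VAll.All Q (x ∷ xs)
  head⇒all up [-]          q = q ∷ []
  head⇒all up (x⊑y ∷ rest) q with rest
  ... | [-]   = q ∷ head⇒all up rest (up _ _ x⊑y q)
  ... | _ ∷ _ = q ∷ head⇒all up rest (up _ _ x⊑y q)

  -- The least element of a chain decides which of the two up-sets contains it.
  chainSum-∪-∩ : (Q? : Decidable Q) (Q′? : Decidable Q′) → UpSet Q → UpSet Q′ →
                 chainSum (λ x → Q? x ⊎-dec Q′? x) ⊕ chainSum (λ x → Q? x ×-dec Q′? x) ≈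
                 chainSum Q? ⊕ chainSum Q′?
  chainSum-∪-∩ {Q} {Q′} Q? Q′? up up′ k m =
    trans (sym (∑-+ (vectors elements m) _ _))
      (trans (∑-cong (vectors elements m) pointwise) (∑-+ (vectors elements m) _ _))
    where
    split : (xs : Vec Carrier m) → Chain (λ x → Q x ⊎ Q′ x) xs → Chain Q xs ⊎ Chain Q′ xs
    -- The empty chain lies in both up-sets; either alternative is valid.
    split []       (l , _)          = inj₁ (l , [])
    split (x ∷ xs) (l , inj₁ q ∷ _) = inj₁ (l , head⇒all up l q)
    split (x ∷ xs) (l , inj₂ q ∷ _) = inj₂ (l , head⇒all up′ l q)

    pointwise : ∀ xs →
      𝟙 (chain? (λ x → Q? x ⊎-dec Q′? x) xs) *ᶻ δ (rankSum xs) k +ᶻ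
      𝟙 (chain? (λ x → Q? x ×-dec Q′? x) xs) *ᶻ δ (rankSum xs) k ≡
      𝟙 (chain? Q? xs) *ᶻ δ (rankSum xs) k +ᶻ 𝟙 (chain? Q′? xs) *ᶻ δ (rankSum xs) k
    pointwise xs = trans (sym (ℤₚ.*-distribʳ-+ d (𝟙 c∪) (𝟙 c∩))) (trans (cong (_*ᶻ d) (trans
        (cong₂ _+ᶻ_
          (𝟙-cong c∪ (c ⊎-dec c′)
            (mk⇔ (split xs) Sum.[ Product.map₂ (VAll.map inj₁) , Product.map₂ (VAll.map inj₂) ]))
          (𝟙-cong c∩ (c ×-dec c′)
            (mk⇔ (λ (l , qs) → (l , VAll.map proj₁ qs) , (l , VAll.map proj₂ qs))
                 (λ ((l , qs) , (_ , qs′)) → l , VAll.zip (qs , qs′)))))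
        (𝟙-⊎-× c c′)))
      (ℤₚ.*-distribʳ-+ d (𝟙 c) (𝟙 c′)))
      where
      d = δ (rankSum xs) k
      c = chain? Q? xs
      c′ = chain? Q′? xs
      c∪ = chain? (λ x → Q? x ⊎-dec Q′? x) xs
      c∩ = chain? (λ x → Q? x ×-dec Q′? x) xs

  infix 4 _⊏?_
  _⊏?_ : ∀ x y → Dec (x ⊑ y × y ≢ x)
  x ⊏? y = (x ⊑? y) ×-dec ¬? (y ≤P.≟ x)

  qshift-weight : ∀ (c : ℤ) a s k → qshift a (λ k → c *ᶻ δ s k) k ≡ c *ᶻ δ (a + s) k
  qshift-weight c a s k = trans (qshift-*ˡ a c (δ s) k) (cong (c *ᶻ_) (qshift-δ a s k))

  -- A nonempty chain above `x` either starts with `x`, and deleting that entry leaves any chain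
  -- above `x` at the cost of q^rank t, or lies strictly above `x`. The empty chain is counted by
  -- the last summand.
  chainSum-↑ : ∀ x → chainSum (x ⊑?_) ≈ shift (rank x) (chainSum (x ⊑?_)) ⊕ chainSum (x ⊏?_)
  chainSum-↑ x k zero    = sym (ℤₚ.+-identityˡ _)
  chainSum-↑ x k (suc m) =
    trans (∑-vectors elements m _)
      (trans (∑-cong elements λ y → trans (∑-cong (vectors elements m) (split y))
                                          (∑-+ (vectors elements m) (repeated y) (strict y)))
        (trans (∑-+ elements _ _)
          (cong₂ _+ᶻ_
            (trans (∑-single unique (complete x) _ λ y y≢x → ∑-zero (vectors elements m) λ ys →
                     cong (λ c → c *ᶻ 𝟙 (chain? (x ⊑?_) ys) *ᶻ δ (rank y + rankSum ys) k)
                       (𝟙-no (y ≤P.≟ x) y≢x))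
              (trans (∑-cong (vectors elements m) first)
                (sym (qshift-∑ (rank x) (vectors elements m) _ k))))
            (sym (∑-vectors elements m _)))))
    where
    repeated strict : Carrier → Vec Carrier m → ℤ
    repeated y ys = 𝟙 (y ≤P.≟ x) *ᶻ 𝟙 (chain? (x ⊑?_) ys) *ᶻ δ (rank y + rankSum ys) k
    strict y ys = 𝟙 (chain? (x ⊏?_) (y ∷ ys)) *ᶻ δ (rank y + rankSum ys) k

    first : ∀ ys → repeated x ys ≡
            qshift (rank x) (λ k → 𝟙 (chain? (x ⊑?_) ys) *ᶻ δ (rankSum ys) k) k
    first ys = trans
      (cong (_*ᶻ δ (rank x + rankSum ys) k)
        (trans (cong (_*ᶻ 𝟙 (chain? (x ⊑?_) ys)) (𝟙-yes (x ≤P.≟ x) refl)) (ℤₚ.*-identityˡ _)))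
      (sym (qshift-weight (𝟙 (chain? (x ⊑?_) ys)) (rank x) (rankSum ys) k))

    extend : ∀ {n} (ys : Vec Carrier n) → Chain (x ⊑_) ys → Chain (x ⊑_) (x ∷ ys)
    extend []       _                   = [-] , (≤P.refl ∷ [])
    extend (y ∷ ys) (l , x⊑y ∷ x⊑ys) = (x⊑y ∷ l) , (≤P.refl ∷ x⊑y ∷ x⊑ys)

    tail : ∀ {n y} {ys : Vec Carrier n} → Linked _⊑_ (y ∷ ys) → Linked _⊑_ ys
    tail [-]     = []
    tail (_ ∷ l) = l

    -- By antisymmetry a chain that has left `x` cannot return to it.
    up-⊏ : UpSet (λ y → x ⊑ y × y ≢ x)
    up-⊏ _ _ y⊑z (x⊑y , y≢x) =
      ≤P.trans x⊑y y⊑z , λ { refl → y≢x (≤P.antisym y⊑z x⊑y) }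

    cases : ∀ y (ys : Vec Carrier m) →
            Chain (x ⊑_) (y ∷ ys) ⇔ ((y ≡ x × Chain (x ⊑_) ys) ⊎ Chain (λ y → x ⊑ y × y ≢ x) (y ∷ ys))
    cases y ys = mk⇔ to
      Sum.[ (λ { (refl , c) → extend ys c }) , Product.map₂ (VAll.map proj₁) ]
      where
      to : Chain (x ⊑_) (y ∷ ys) → (y ≡ x × Chain (x ⊑_) ys) ⊎ Chain (λ y → x ⊑ y × y ≢ x) (y ∷ ys)
      to (l , x⊑y ∷ x⊑ys) with y ≤P.≟ x
      ... | yes y≡x = inj₁ (y≡x , tail l , x⊑ys)
      ... | no  y≢x = inj₂ (l , head⇒all up-⊏ l (x⊑y , y≢x))

    split : ∀ y ys → 𝟙 (chain? (x ⊑?_) (y ∷ ys)) *ᶻ δ (rank y + rankSum ys) k ≡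
                     repeated y ys +ᶻ strict y ys
    split y ys = trans
      (cong (_*ᶻ δ (rank y + rankSum ys) k) (trans
        (𝟙-⊎ s t (chain? (x ⊑?_) (y ∷ ys)) (cases y ys) disjoint)
        (cong (_+ᶻ 𝟙 t) (𝟙-× (y ≤P.≟ x) (chain? (x ⊑?_) ys)))))
      (ℤₚ.*-distribʳ-+ (δ (rank y + rankSum ys) k)
        (𝟙 (y ≤P.≟ x) *ᶻ 𝟙 (chain? (x ⊑?_) ys)) (𝟙 t))
      where
      s = (y ≤P.≟ x) ×-dec chain? (x ⊑?_) ys
      t = chain? (x ⊏?_) (y ∷ ys)
      disjoint : ¬ ((y ≡ x × Chain (x ⊑_) ys) × Chain (λ y → x ⊑ y × y ≢ x) (y ∷ ys))
      disjoint ((y≡x , _) , (_ , (_ , y≢x) ∷ _)) = y≢x y≡x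

  factor-chainSum-↑ : ∀ x → factor (rank x) (chainSum (x ⊑?_)) ≈ chainSum (x ⊏?_)
  factor-chainSum-↑ x = ⊕-cancelʳ s (≈-trans (factor-⊕-shift (rank x) z)
    (≈-trans (chainSum-↑ x) λ k m → ℤₚ.+-comm (s k m) (chainSum (x ⊏?_) k m)))
    where
    z = chainSum (x ⊑?_)
    s = shift (rank x) z

-- The statistic of D(w), read off letter by letter

filter-map-suc : ∀ {n} {Q : Pred (Fin (suc n)) 0ℓ} (Q? : Decidable Q) xs →
                 filter Q? (map Fin.suc xs) ≡ map Fin.suc (filter (Q? ∘ Fin.suc) xs)
filter-map-suc Q? []       = refl
filter-map-suc Q? (x ∷ xs) with Q? (Fin.suc x)
... | yes _ = cong (Fin.suc x ∷_) (filter-map-suc Q? xs)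
... | no  _ = filter-map-suc Q? xs

filterSum : ∀ {n} {Q : Pred (Fin n) 0ℓ} → Decidable Q → (Fin n → ℕ) → ℕ
filterSum {n} Q? g = sum (map g (filter Q? (allFin n)))

filterSum-suc : ∀ {n} {Q : Pred (Fin (suc n)) 0ℓ} (Q? : Decidable Q) g →
  filterSum Q? g ≡
  (if does (Q? Fin.zero) then g Fin.zero else 0) + filterSum (Q? ∘ Fin.suc) (g ∘ Fin.suc)
filterSum-suc {n} Q? g = trans head (cong ((if does (Q? Fin.zero) then g Fin.zero else 0) +_)
  (trans (cong (sum ∘ map g ∘ filter Q?) (sym (map-tabulate id Fin.suc)))
    (trans (cong (sum ∘ map g) (filter-map-suc Q? (allFin n)))
      (cong sum (sym (map-∘ (filter (Q? ∘ Fin.suc) (allFin n))))))))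
  where
  tail = tabulate {n = n} Fin.suc
  head : filterSum Q? g ≡
         (if does (Q? Fin.zero) then g Fin.zero else 0) + sum (map g (filter Q? tail))
  head with Q? Fin.zero
  ... | yes _ = refl
  ... | no  _ = refl

filterSum-cong : ∀ {n} {Q Q′ : Pred (Fin n) 0ℓ} (Q? : Decidable Q) (Q′? : Decidable Q′) {g g′} →
                 (∀ j → Q j ⇔ Q′ j) → (∀ j → g j ≡ g′ j) → filterSum Q? g ≡ filterSum Q′? g′
filterSum-cong {n} Q? Q′? {g} Q⇔Q′ g≗g′ = cong sum (trans
  (cong (map g) (filter-≐ Q? Q′? ((λ {j} → Equivalence.to (Q⇔Q′ j)) , λ {j} → Equivalence.from (Q⇔Q′ j))
                          (allFin n)))
  (map-cong g≗g′ (filter Q′? (allFin n))))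

-- InD for a word whose first letter is preceded by the letter p.
InDAfter : ∀ {n} → Letter → Word n → Fin n → Set
InDAfter {n} p w j =
  lookup w j ≡ L ×
  ((toℕ j ≡ 0 × p ≡ R) ⊎ Σ (Fin n) λ i → suc (toℕ i) ≡ toℕ j × lookup w i ≡ R)

inDAfter? : ∀ {n} p (w : Word n) → Decidable (InDAfter p w)
inDAfter? p w j = (lookup w j ≟ˡ L) ×-dec
  (((toℕ j ≟ 0) ×-dec (p ≟ˡ R)) ⊎-dec
   any? λ i → (suc (toℕ i) ≟ toℕ j) ×-dec (lookup w i ≟ˡ R))

InDAfter-suc : ∀ {n} p x (w : Word n) j → InDAfter p (x ∷ w) (Fin.suc j) ⇔ InDAfter x w j
InDAfter-suc p x w j = mk⇔ to from
  where
  to : InDAfter p (x ∷ w) (Fin.suc j) → InDAfter x w j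
  to (l , inj₂ (Fin.zero  , eq , r)) = l , inj₁ (sym (suc-injective eq) , r)
  to (l , inj₂ (Fin.suc i , eq , r)) = l , inj₂ (i , suc-injective eq , r)
  from : InDAfter x w j → InDAfter p (x ∷ w) (Fin.suc j)
  from (l , inj₁ (eq , r))     = l , inj₂ (Fin.zero , cong suc (sym eq) , r)
  from (l , inj₂ (i , eq , r)) = l , inj₂ (Fin.suc i , cong suc eq , r)

-- Here `p` is the preceding letter and `h` the position counted from zero. The choices `id` and
-- `λ _ → 1` of `f` give the exponents of q and t. On paths from a minimal cell `h` is also the
-- rank, as every letter raises the rank by one.
descentSum : (ℕ → ℕ) → ∀ {n} → Letter → ℕ → Word n → ℕ
descentSum f p h []      = 0
descentSum f p h (R ∷ w) = descentSum f R (suc h) w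
descentSum f R h (L ∷ w) = f h + descentSum f L (suc h) w
descentSum f L h (L ∷ w) = descentSum f L (suc h) w

descentSum-filterSum : ∀ f {n} p h (w : Word n) →
  filterSum (inDAfter? p w) (λ j → f (h + toℕ j)) ≡ descentSum f p h w
descentSum-filterSum f p h []      = refl
descentSum-filterSum f p h (x ∷ w) =
  trans (filterSum-suc (inDAfter? p (x ∷ w)) (λ j → f (h + toℕ j))) (first p x
    (trans (filterSum-cong (inDAfter? p (x ∷ w) ∘ Fin.suc) (inDAfter? x w)
              (InDAfter-suc p x w) (λ j → cong f (+-suc h (toℕ j))))
           (descentSum-filterSum f x (suc h) w)))
  where
  first : ∀ p x {s} → s ≡ descentSum f x (suc h) w →
    (if does (inDAfter? p (x ∷ w) Fin.zero) then f (h + 0) else 0) + s ≡ descentSum f p h (x ∷ w)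
  first p R eq = eq
  first R L eq = cong₂ _+_ (cong f (+-identityʳ h)) eq
  -- Index 0 is not counted after `L`: the preceding letter is not `R`, and no index of the word
  -- precedes it.
  first L L {s} eq = trans (cong (λ d → (if d then f (h + 0) else 0) + s)
    (dec-false (inDAfter? L (L ∷ w) Fin.zero) λ { (_ , inj₁ (_ , ())) ; (_ , inj₂ (_ , () , _)) })) eq

sum-map-1 : ∀ (xs : List X) → sum (map (λ _ → 1) xs) ≡ length xs
sum-map-1 []       = refl
sum-map-1 (x ∷ xs) = cong suc (sum-map-1 xs)

-- An imaginary `R` in front of the word reproduces the convention that an initial `L` belongs to
-- D(w).
InD⇔InDAfter-R : ∀ {n} (w : Word n) j → InD w j ⇔ InDAfter R w j
InD⇔InDAfter-R w j = mk⇔ (Product.map₂ (Sum.map₁ (_, refl))) (Product.map₂ (Sum.map₁ proj₁))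

sum-D : ∀ {n} (w : Word n) → sum (map toℕ (D w)) ≡ descentSum id R 0 w
sum-D w = trans (filterSum-cong (inD? w) (inDAfter? R w) (InD⇔InDAfter-R w) (λ _ → refl))
                (descentSum-filterSum id R 0 w)

length-D : ∀ {n} (w : Word n) → length (D w) ≡ descentSum (λ _ → 1) R 0 w
length-D w = trans (sym (sum-map-1 (D w)))
  (trans (filterSum-cong (inD? w) (inDAfter? R w) {λ _ → 1} (InD⇔InDAfter-R w) (λ _ → refl))
         (descentSum-filterSum (λ _ → 1) R 0 w))

monomial : ∀ {n} → Letter → ℕ → Word n → Series
monomial p h w = q^ descentSum id p h w t^ descentSum (λ _ → 1) p h w

letters : List Letter
letters = L ∷ R ∷ []

-- Generating functions of lattice paths

-- The charge for a leading `L` at height `h`: free after `L`, a factor q^h t after `R`.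
step : Letter → ℕ → Series → Series
step L h f = f
step R h f = shift h f

module Paths (b : ℕ → ℕ) where

  -- The prefix condition with the starting cell `(suc i , c)` detached from the word, so that it
  -- survives the removal of a first letter: `v` ends in row `suc i ∸ occurrences L v` and column
  -- `c + occurrences R v`.
  Inside : ℕ → ℕ → List Letter → Set
  Inside i c v = c + occurrences R v ≤ b (suc i ∸ occurrences L v)

  -- u leads from the cell (suc i , c) to row 1 without leaving the diagram.
  Path : ∀ {n} → ℕ → ℕ → Word n → Set
  Path i c u = ℓ u ≡ i × All (Inside i c) (inits (toList u))

  path? : ∀ {n} i c (u : Word n) → Dec (Path i c u)
  path? i c u = (ℓ u ≟ i) ×-dec All.all? (λ _ → _ ≤? _) (inits (toList u))

  path⇒inside : ∀ {n} i c (u : Word n) → Path i c u → c ≤ b (suc i)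
  path⇒inside i c u (_ , c≤b ∷ _) = subst (_≤ b (suc i)) (+-identityʳ c) c≤b

  -- The empty prefix accounts for the bound on `c`; every other prefix starts with `L` and becomes
  -- a prefix of `u` seen from the row above.
  path-L : ∀ {n} i c (u : Word n) → c ≤ b (suc (suc i)) → Path (suc i) c (L ∷ u) ⇔ Path i c u
  path-L i c u c≤b = mk⇔
    (λ { (l , _ ∷ ps) → suc-injective l , Allₚ.map⁻ {f = L ∷_} ps })
    (λ (l , ps) → cong suc l ,
      subst (_≤ b (suc (suc i))) (sym (+-identityʳ c)) c≤b ∷ Allₚ.map⁺ {f = L ∷_} ps)

  path-R : ∀ {n} i c (u : Word n) → c ≤ b (suc i) → Path i c (R ∷ u) ⇔ Path i (suc c) u
  path-R i c u c≤b = mk⇔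
    (λ { (l , _ ∷ ps) → l ,
      All.map (λ {v} → subst (_≤ b (suc i ∸ occurrences L v)) (+-suc c (occurrences R v)))
              (Allₚ.map⁻ {f = R ∷_} ps) })
    (λ (l , ps) → l ,
      subst (_≤ b (suc i)) (sym (+-identityʳ c)) c≤b ∷
      Allₚ.map⁺ {f = R ∷_} (All.map
        (λ {v} → subst (_≤ b (suc i ∸ occurrences L v)) (sym (+-suc c (occurrences R v)))) ps))

  pathSum : Letter → (n i c h : ℕ) → Series
  pathSum p n i c h k m = ∑ (vectors letters n) λ u → 𝟙 (path? i c u) *ᶻ monomial p h u k m

  pathSum-outside : ∀ p n i c h → ¬ c ≤ b (suc i) → ∀ k m → pathSum p n i c h k m ≡ 0ℤ
  pathSum-outside p n i c h c≰b k m = ∑-zero (vectors letters n) λ u →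
    cong (_*ᶻ monomial p h u k m) (𝟙-no (path? i c u) (c≰b ∘ path⇒inside i c u))

  pathSum-split : ∀ p n i c h k m → pathSum p (suc n) i c h k m ≡
    ∑ (vectors letters n) (λ u → 𝟙 (path? i c (L ∷ u)) *ᶻ monomial p h (L ∷ u) k m) +ᶻ
    ∑ (vectors letters n) (λ u → 𝟙 (path? i c (R ∷ u)) *ᶻ monomial p h (R ∷ u) k m)
  pathSum-split p n i c h k m =
    trans (∑-vectors letters n (λ u → 𝟙 (path? i c u) *ᶻ monomial p h u k m))
      (cong (∑ (vectors letters n) (λ u → 𝟙 (path? i c (L ∷ u)) *ᶻ monomial p h (L ∷ u) k m) +ᶻ_)
        (ℤₚ.+-identityʳ _))

  pathSum-R∷ : ∀ p n i c h → c ≤ b (suc i) → ∀ k m →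
    ∑ (vectors letters n) (λ u → 𝟙 (path? i c (R ∷ u)) *ᶻ monomial p h (R ∷ u) k m) ≡
    pathSum R n i (suc c) (suc h) k m
  pathSum-R∷ p n i c h c≤b k m = ∑-cong (vectors letters n) λ u →
    cong (_*ᶻ monomial R (suc h) u k m)
      (𝟙-cong (path? i c (R ∷ u)) (path? i (suc c) u) (path-R i c u c≤b))

  pathSum-L∷ : ∀ p n i c h → c ≤ b (suc (suc i)) → ∀ k m →
    ∑ (vectors letters n) (λ u → 𝟙 (path? (suc i) c (L ∷ u)) *ᶻ monomial p h (L ∷ u) k m) ≡
    step p h (pathSum L n i c (suc h)) k m
  pathSum-L∷ p n i c h c≤b k m = trans
    (∑-cong (vectors letters n) λ u → cong₂ _*ᶻ_
      (𝟙-cong (path? (suc i) c (L ∷ u)) (path? i c u) (path-L i c u c≤b)) (monomial-L∷ p u))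
    (step-∑ p)
    where
    monomial-L∷ : ∀ p u → monomial p h (L ∷ u) k m ≡ step p h (monomial L (suc h) u) k m
    monomial-L∷ L u = refl
    monomial-L∷ R u = q^t^-shift h (descentSum id L (suc h) u) (descentSum (λ _ → 1) L (suc h) u) k m
    step-∑ : ∀ p → ∑ (vectors letters n) (λ u → 𝟙 (path? i c u) *ᶻ step p h (monomial L (suc h) u) k m) ≡
                   step p h (pathSum L n i c (suc h)) k m
    step-∑ L = refl
    step-∑ R = sym (shift-∑ h (vectors letters n) (λ u → 𝟙 (path? i c u)) (monomial L (suc h)) k m)

  pathSum-suc : ∀ p n i c h → c ≤ b (suc (suc i)) → pathSum p (suc n) (suc i) c h ≈
                step p h (pathSum L n i c (suc h)) ⊕ pathSum R n (suc i) (suc c) (suc h)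
  pathSum-suc p n i c h c≤b k m = trans (pathSum-split p n (suc i) c h k m)
    (cong₂ _+ᶻ_ (pathSum-L∷ p n i c h c≤b k m) (pathSum-R∷ p n (suc i) c h c≤b k m))

  pathSum-row1 : ∀ p n c h → c ≤ b 1 → pathSum p (suc n) 0 c h ≈ pathSum R n 0 (suc c) (suc h)
  pathSum-row1 p n c h c≤b k m = trans (pathSum-split p n 0 c h k m)
    (trans (cong₂ _+ᶻ_
        (∑-zero (vectors letters n) λ u → cong (_*ᶻ monomial p h (L ∷ u) k m)
          (𝟙-no (path? 0 c (L ∷ u)) λ ()))
        (pathSum-R∷ p n 0 c h c≤b k m))
      (ℤₚ.+-identityˡ _))

  -- Paths in row 1 consist of letters `R` only, so the preceding letter never decides a charge.
  pathSum-row1-irrelevant : ∀ p p′ n c h → c ≤ b 1 → pathSum p n 0 c h ≈ pathSum p′ n 0 c h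
  pathSum-row1-irrelevant p p′ zero    c h c≤b = ≈-refl
  pathSum-row1-irrelevant p p′ (suc n) c h c≤b =
    ≈-trans (pathSum-row1 p n c h c≤b) (≈-sym (pathSum-row1 p′ n c h c≤b))

  pathSum-end : ∀ p c h → c ≤ b 1 → pathSum p 0 0 c h ≈ q^ 0 t^ 0
  pathSum-end p c h c≤b k m = trans (ℤₚ.+-identityʳ _)
    (trans (cong (_*ᶻ (q^ 0 t^ 0) k m)
             (𝟙-yes (path? 0 c []) (refl , subst (_≤ b 1) (sym (+-identityʳ c)) c≤b ∷ [])))
           (ℤₚ.*-identityˡ _))

  -- The two series differ only in the charge of a leading `L`: its contribution is `w` after `L`
  -- and q^h t `w` after `R`. This difference is the counterpart of the correction term for chains.
  pathSum-L≈R⊕ : ∀ n i c h → c ≤ b (suc (suc i)) → pathSum L (suc n) (suc i) c h ≈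
                 pathSum R (suc n) (suc i) c h ⊕ factor h (pathSum L n i c (suc h))
  pathSum-L≈R⊕ n i c h c≤b k m = trans (pathSum-suc L n i c h c≤b k m)
    (trans (rearrange (w k m) (shift h w k m) (pathSum R n (suc i) (suc c) (suc h) k m))
           (cong (_+ᶻ factor h w k m) (sym (pathSum-suc R n i c h c≤b k m))))
    where
    w = pathSum L n i c (suc h)
    rearrange : ∀ x s y → x +ᶻ y ≡ (s +ᶻ y) +ᶻ (x -ᶻ s)
    rearrange = solve-∀

-- Cells of the Ferrers poset

module Ferrers {r : ℕ} {b : ℕ → ℕ} (S : IsShape r b) (M : ℕ) (b₁≡1+M : b 1 ≡ suc M) where
  open IsShape S
  open Paths b
  open ChainSums (ferrersPoset S)

  -- The pair `(i , c)` need not be a cell: row bound 0 gives the empty set, and column bound 0 is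
  -- no restriction.
  Corner : ℕ → ℕ → FerrersCell r b → Set
  Corner i c x = row x ≤ i × c ≤ col x

  corner? : ∀ i c → Decidable (Corner i c)
  corner? i c x = (row x ≤? i) ×-dec (c ≤? col x)

  corner-up : ∀ i c → UpSet (Corner i c)
  corner-up i c _ _ (j≤ , ≤d) (row≤ , ≤col) = ≤-trans j≤ row≤ , ≤-trans ≤col ≤d

  Z : ℕ → ℕ → Series
  Z i c = chainSum (corner? i c)

  b≤1+M : ∀ i → 1 ≤ i → i ≤ r → b i ≤ suc M
  b≤1+M i 1≤i i≤r = subst (b i ≤_) b₁≡1+M (antitone S i 1≤i i≤r)

  row≥1 : (x : FerrersCell r b) → 1 ≤ row x
  row≥1 (cell _ _ (p , _)) = p

  row≤col : (x : FerrersCell r b) → row x ≤ col x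
  row≤col (cell _ _ (_ , _ , p , _)) = p

  col≤b : (x : FerrersCell r b) → col x ≤ b (row x)
  col≤b (cell _ _ (_ , _ , _ , p)) = p

  module _ {i c : ℕ} (i<r : suc i ≤ r) (i<c : suc i ≤ c) (c≤b : c ≤ b (suc i)) where

    corner : FerrersCell r b
    corner = cell (suc i) c (s≤s z≤n , i<r , i<c , c≤b)

    -- The factor with exponent `h`, the rank of the corner, is moved innermost, where it deletes
    -- the corner from its up-set.
    Z-factor : ∀ h n → c ≡ suc i + h →
               factors h (suc n) (Z (suc i) c) ≈ factors (suc h) n (chainSum (corner ⊏?_))
    Z-factor h n refl = ≈-trans (≈-sym (factors-factor h (suc h) n (Z (suc i) c)))
      (factors-cong (suc h) n
        (subst (λ a → factor a (Z (suc i) c) ≈ chainSum (corner ⊏?_)) (m+n∸m≡n (suc i) h)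
          (factor-chainSum-↑ corner)))

    ⊏-cases : ∀ y → corner ⊑ᶜ y × y ≢ corner → Corner i c y ⊎ Corner (suc i) (suc c) y
    ⊏-cases y ((row≤ , ≤col) , y≢x) with m≤n⇒m<n∨m≡n row≤ | m≤n⇒m<n∨m≡n ≤col
    ... | inj₁ row< | _         = inj₁ (s≤s⁻¹ row< , ≤col)
    ... | inj₂ row≡ | inj₁ <col = inj₂ (row≤ , <col)
    ... | inj₂ row≡ | inj₂ ≡col = contradiction (cell-≡ row≡ (sym ≡col)) y≢x

    corner⇒⊏ : ∀ y → Corner i c y ⊎ Corner (suc i) (suc c) y → corner ⊑ᶜ y × y ≢ corner
    corner⇒⊏ y (inj₁ (row≤ , ≤col)) =
      (m≤n⇒m≤1+n row≤ , ≤col) , λ { refl → 1+n≰n row≤ }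
    corner⇒⊏ y (inj₂ (row≤ , <col)) =
      (row≤ , <⇒≤ <col) , λ { refl → 1+n≰n <col }

    -- Without its corner the region is the union of the regions one row up and one column to the
    -- right, which meet in `Corner i (suc c)`.
    Z-⊏ : chainSum (corner ⊏?_) ⊕ Z i (suc c) ≈ Z i c ⊕ Z (suc i) (suc c)
    Z-⊏ = ≈-trans (⊕-cong
        (chainSum-cong (corner ⊏?_) (λ y → corner? i c y ⊎-dec corner? (suc i) (suc c) y)
          λ y → mk⇔ (⊏-cases y) (corner⇒⊏ y))
        (chainSum-cong (corner? i (suc c)) (λ y → corner? i c y ×-dec corner? (suc i) (suc c) y)
          λ y → mk⇔ (λ (row≤ , <col) → (row≤ , <⇒≤ <col) , (m≤n⇒m≤1+n row≤ , <col))
                    (λ ((row≤ , _) , (_ , <col)) → row≤ , <col)))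
      (chainSum-∪-∩ (corner? i c) (corner? (suc i) (suc c)) (corner-up i c) (corner-up (suc i) (suc c)))

    -- If row `suc i` ends at column `c`, the region to the right has no cell in that row and is
    -- contained in the region one row up.
    Z-⊏-left : ¬ suc c ≤ b (suc i) → chainSum (corner ⊏?_) ≈ Z i c
    Z-⊏-left c≮b = chainSum-cong (corner ⊏?_) (corner? i c)
      λ y → mk⇔ (λ x⊏y → to y (⊏-cases y x⊏y)) (corner⇒⊏ y ∘ inj₁)
      where
      to : ∀ y → Corner i c y ⊎ Corner (suc i) (suc c) y → Corner i c y
      to y (inj₁ p) = p
      to y (inj₂ (row≤ , <col)) with m≤n⇒m<n∨m≡n row≤
      ... | inj₁ row< = s≤s⁻¹ row< , <⇒≤ <col
      ... | inj₂ row≡ = contradiction (≤-trans <col (subst (λ j → col y ≤ b j) row≡ (col≤b y))) c≮b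

  no-row-0 : ∀ {c} y → ¬ Corner 0 c y
  no-row-0 y (row≤0 , _) = 1+n≰n (≤-trans (row≥1 y) row≤0)

  Z-⊏-top-row : ∀ {c} (1≤r : 1 ≤ r) (1≤c : 1 ≤ c) (c≤b : c ≤ b 1) →
                chainSum (corner 1≤r 1≤c c≤b ⊏?_) ≈ Z 1 (suc c)
  Z-⊏-top-row {c} 1≤r 1≤c c≤b = chainSum-cong (corner 1≤r 1≤c c≤b ⊏?_) (corner? 1 (suc c)) λ y →
    mk⇔ (λ x⊏y → Sum.[ (λ p → contradiction p (no-row-0 y)) , id ] (⊏-cases 1≤r 1≤c c≤b y x⊏y))
        (λ p → corner⇒⊏ 1≤r 1≤c c≤b y (inj₂ p))

  Z-∅ : ∀ c → b 1 < c → Z 1 c ≈ q^ 0 t^ 0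
  Z-∅ c b<c = chainSum-∅ (corner? 1 c) λ y (row≤1 , c≤col) →
    1+n≰n (≤-trans b<c (≤-trans c≤col
      (subst (λ j → col y ≤ b j) (≤-antisym row≤1 (row≥1 y)) (col≤b y))))

  -- Induction on `n`, the number of steps left to the top cell. The preceding letter is `L` because
  -- `Z i c` enters the chain recursion without a weight, so a leading `L` must be free.
  Z-pathSum : ∀ n {i c h} → suc i ≤ r → c ≡ suc i + h → c ≤ b (suc i) → h + n ≡ M →
              factors h (suc n) (Z (suc i) c) ≈ pathSum L n i c h
  Z-pathSum zero {zero} {c} {h} i<r refl c≤b h+n≡M = ≈-trans (Z-factor i<r (s≤s z≤n) c≤b h 0 refl)
    (≈-trans (Z-⊏-top-row i<r (s≤s z≤n) c≤b)
      (≈-trans (Z-∅ (suc c) (s≤s (≤-reflexive (trans b₁≡1+M (cong suc (trans (sym h+n≡M) (+-identityʳ h)))))))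
        (≈-sym (pathSum-end L c h c≤b))))
  -- Rank `M` occurs only at the top: below row 1 the column would exceed `b 1`.
  Z-pathSum zero {suc i} {c} {h} i<r refl c≤b h+n≡M = contradiction
    (≤-trans c≤b (≤-trans (b≤1+M (suc (suc i)) (s≤s z≤n) i<r)
      (s≤s (≤-trans (≤-reflexive (trans (sym h+n≡M) (+-identityʳ h))) (m≤n+m h i)))))
    1+n≰n
  Z-pathSum (suc n) {zero} {c} {h} i<r refl c≤b h+n≡M =
    ≈-trans (Z-factor i<r (s≤s z≤n) c≤b h (suc n) refl)
      (≈-trans (factors-cong (suc h) (suc n) (Z-⊏-top-row i<r (s≤s z≤n) c≤b))
        (≈-trans (Z-pathSum n i<r refl c<b h+n≡M′)
          (≈-trans (pathSum-row1-irrelevant L R n (suc c) (suc h) c<b)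
            (≈-sym (pathSum-row1 L n c h c≤b)))))
    where
    h+n≡M′ : suc h + n ≡ M
    h+n≡M′ = trans (sym (+-suc h n)) h+n≡M
    c<b : suc c ≤ b 1
    c<b = subst (suc c ≤_) (sym b₁≡1+M) (s≤s (subst (suc h ≤_) h+n≡M′ (m≤m+n (suc h) n)))
  Z-pathSum (suc n) {suc i} {c} {h} i<r refl c≤b h+n≡M with suc c ≤? b (suc (suc i))
  -- The right neighbour is outside the diagram, so on both sides only the step to the row above
  -- survives.
  ... | no c≮b = ≈-trans (Z-factor i<r i<c c≤b h (suc n) refl)
    (≈-trans (factors-cong (suc h) (suc n) (Z-⊏-left i<r i<c c≤b c≮b))
      (≈-trans (Z-pathSum n (<⇒≤ i<r) (cong suc (sym (+-suc i h))) c≤b′ (trans (sym (+-suc h n)) h+n≡M))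
        λ k m → sym (trans (pathSum-suc L n i c h c≤b k m)
          (trans (cong (pathSum L n i c (suc h) k m +ᶻ_)
                   (pathSum-outside R n (suc i) (suc c) (suc h) c≮b k m))
                 (ℤₚ.+-identityʳ _)))))
    where
    i<c : suc (suc i) ≤ c
    i<c = m≤m+n (suc (suc i)) h
    c≤b′ : c ≤ b (suc i)
    c≤b′ = ≤-trans c≤b (decreasing (suc i) (s≤s z≤n) i<r)
  -- The right neighbour would have rank `M` without being the top cell.
  Z-pathSum (suc zero) {suc i} {c} {h} i<r refl c≤b h+n≡M | yes c<b = contradiction
    (≤-trans c<b (≤-trans (b≤1+M (suc (suc i)) (s≤s z≤n) i<r)
      (s≤s (≤-trans (≤-reflexive (trans (sym h+n≡M) (+-comm h 1))) (s≤s (m≤n+m h i))))))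
    1+n≰n
  Z-pathSum (suc (suc n)) {suc i} {c} {h} i<r refl c≤b h+n≡M | yes c<b =
    ≈-trans (Z-factor i<r i<c c≤b h (suc (suc n)) refl)
      -- The correction `Z (suc i) (suc c)` belongs to a cell of rank `suc (suc h)`, so the
      -- induction hypothesis turns it into `w` and leaves `factor (suc h)` in front. This is the
      -- excess that `pathSum-L≈R⊕` produces.
      (⊕-cancelʳ (factor (suc h) w) (≈-trans
        (⊕-cong (≈-refl {factors (suc h) (suc (suc n)) Z°})
          (factor-cong (suc h) (≈-sym (Z-pathSum n (<⇒≤ i<r) c≡₂ c<b′ h+n≡M₂))))
        (≈-trans (factors-⊕-cong (suc h) (suc (suc n)) (Z-⊏ i<r i<c c≤b))
          (≈-trans (⊕-cong (Z-pathSum (suc n) (<⇒≤ i<r) c≡₁ (≤-trans (n≤1+n c) c<b′) h+n≡M₁)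
                           (Z-pathSum (suc n) i<r c≡₃ c<b h+n≡M₁))
            (≈-trans (⊕-cong (≈-refl {pathSum L (suc n) i c (suc h)})
                             (pathSum-L≈R⊕ n i (suc c) (suc h) c<b))
              λ k m → trans
                (sym (ℤₚ.+-assoc (pathSum L (suc n) i c (suc h) k m)
                  (pathSum R (suc n) (suc i) (suc c) (suc h) k m) (factor (suc h) w k m)))
                (cong (_+ᶻ factor (suc h) w k m) (sym (pathSum-suc L (suc n) i c h c≤b k m))))))))
    where
    i<c : suc (suc i) ≤ c
    i<c = m≤m+n (suc (suc i)) h
    Z° = chainSum (corner i<r i<c c≤b ⊏?_)
    w = pathSum L n i (suc c) (suc (suc h))
    c<b′ : suc c ≤ b (suc i)
    c<b′ = ≤-trans c<b (decreasing (suc i) (s≤s z≤n) i<r)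
    c≡₁ : c ≡ suc i + suc h
    c≡₁ = cong suc (sym (+-suc i h))
    c≡₃ : suc c ≡ suc (suc i) + suc h
    c≡₃ = cong suc c≡₁
    c≡₂ : suc c ≡ suc i + suc (suc h)
    c≡₂ = trans c≡₃ (sym (+-suc (suc i) (suc h)))
    h+n≡M₁ : suc h + suc n ≡ M
    h+n≡M₁ = trans (sym (+-suc h (suc n))) h+n≡M
    h+n≡M₂ : suc (suc h) + n ≡ M
    h+n≡M₂ = trans (sym (+-suc (suc h) n)) h+n≡M₁

  -- Words and the collection of minimal cells

  words : List (Word M)
  words = vectors letters M

  -- The shape `b` stays fixed while the row bound `r′` varies, which permits induction on the
  -- number of rows.
  wordSum : ℕ → Series
  wordSum r′ k m = ∑ words λ w → 𝟙 (inW? r′ b w) *ᶻ monomial R 0 w k m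

  Path-diagonal : ∀ {n} i (w : Word n) →
                  Path i (suc i) w ⇔ (ℓ w ≡ i × All (PrefixCondition b w) (inits (toList w)))
  Path-diagonal i w = mk⇔ (λ { (refl , p) → refl , p }) (λ { (refl , p) → refl , p })

  wordSum-1 : wordSum 1 ≈ pathSum R M 0 1 0
  wordSum-1 k m = ∑-cong words λ w → cong (_*ᶻ monomial R 0 w k m)
    (𝟙-cong (inW? 1 b w) (path? 0 1 w)
      (mk⇔ (λ (l , p) → Equivalence.from (Path-diagonal 0 w) (n≤0⇒n≡0 l , p))
           (λ p → Product.map₁ ≤-reflexive (Equivalence.to (Path-diagonal 0 w) p))))

  -- The new words have exactly `suc i` letters `L`, so they are the paths from the minimal cell in
  -- row `suc (suc i)`. The preceding letter is `R` since an initial `L` is charged.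
  wordSum-suc : ∀ i → wordSum (suc (suc i)) ≈ wordSum (suc i) ⊕ pathSum R M (suc i) (suc (suc i)) 0
  wordSum-suc i k m = trans
    (∑-cong words λ w → trans
      (cong (_*ᶻ monomial R 0 w k m)
        (𝟙-⊎ (inW? (suc i) b w) (path? (suc i) (suc (suc i)) w) (inW? (suc (suc i)) b w)
          (mk⇔ (to w) (from w)) (disjoint w)))
      (ℤₚ.*-distribʳ-+ (monomial R 0 w k m) (𝟙 (inW? (suc i) b w)) _))
    (∑-+ words _ _)
    where
    module Diagonal w = Equivalence (Path-diagonal (suc i) w)
    to : ∀ w → InW (suc (suc i)) b w → InW (suc i) b w ⊎ Path (suc i) (suc (suc i)) w
    to w (l , p) with m≤n⇒m<n∨m≡n l
    ... | inj₁ l< = inj₁ (s≤s⁻¹ l< , p)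
    ... | inj₂ l≡ = inj₂ (Diagonal.from w (l≡ , p))
    from : ∀ w → InW (suc i) b w ⊎ Path (suc i) (suc (suc i)) w → InW (suc (suc i)) b w
    from w (inj₁ (l , p)) = m≤n⇒m≤1+n l , p
    from w (inj₂ p) = Product.map₁ ≤-reflexive (Diagonal.to w p)
    disjoint : ∀ w → ¬ (InW (suc i) b w × Path (suc i) (suc (suc i)) w)
    disjoint w ((l , _) , (l≡ , _)) = 1+n≰n (subst (_≤ i) l≡ l)

  -- Cells of the added row lie on or right of the diagonal, so they all belong to the up-set of its
  -- minimal cell.
  Z-rows : ∀ i → Z (suc (suc i)) 0 ⊕ Z (suc i) (suc (suc i)) ≈ Z (suc i) 0 ⊕ Z (suc (suc i)) (suc (suc i))
  Z-rows i = ≈-trans (⊕-cong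
      (chainSum-cong (corner? (suc (suc i)) 0) (λ y → low? y ⊎-dec high? y) λ y →
        mk⇔ (to y) Sum.[ (λ (row≤ , _) → m≤n⇒m≤1+n row≤ , z≤n) , (λ (row≤ , _) → row≤ , z≤n) ])
      (chainSum-cong (corner? (suc i) (suc (suc i))) (λ y → low? y ×-dec high? y) λ y →
        mk⇔ (λ (row≤ , ≤col) → (row≤ , z≤n) , (m≤n⇒m≤1+n row≤ , ≤col))
            (λ ((row≤ , _) , (_ , ≤col)) → row≤ , ≤col)))
    (chainSum-∪-∩ low? high? (corner-up (suc i) 0) (corner-up (suc (suc i)) (suc (suc i))))
    where
    low? = corner? (suc i) 0
    high? = corner? (suc (suc i)) (suc (suc i))
    to : ∀ y → Corner (suc (suc i)) 0 y → Corner (suc i) 0 y ⊎ Corner (suc (suc i)) (suc (suc i)) y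
    to y (row≤ , _) with m≤n⇒m<n∨m≡n row≤
    ... | inj₁ row< = inj₁ (s≤s⁻¹ row< , z≤n)
    ... | inj₂ row≡ = inj₂ (row≤ , subst (_≤ col y) row≡ (row≤col y))

  Z-wordSum : ∀ i → suc i ≤ r → factors 0 (suc M) (Z (suc i) 0) ≈ wordSum (suc i)
  Z-wordSum zero i<r = ≈-trans
    -- Every column is at least 1, so the first row is the up-set of the minimal cell `(1 , 1)`.
    (factors-cong 0 (suc M) (chainSum-cong (corner? 1 0) (corner? 1 1) λ y →
      mk⇔ (λ (row≤ , _) → row≤ , ≤-trans (row≥1 y) (row≤col y)) (Product.map₂ λ _ → z≤n)))
    (≈-trans (Z-pathSum M i<r refl (diagonal 1 ≤-refl i<r) refl)
      (≈-trans (pathSum-row1-irrelevant L R M 1 0 (diagonal 1 ≤-refl i<r)) (≈-sym wordSum-1)))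
  Z-wordSum (suc i) i<r = go M refl
    where
    i≤r = <⇒≤ i<r
    b-diagonal : suc (suc i) ≤ b (suc (suc i))
    b-diagonal = diagonal (suc (suc i)) (s≤s z≤n) i<r
    go : ∀ n → n ≡ M → factors 0 (suc M) (Z (suc (suc i)) 0) ≈ wordSum (suc (suc i))
    -- Two rows force `b 1` to be at least 2, so `M` is positive.
    go zero    refl = contradiction (≤-trans b-diagonal (b≤1+M (suc (suc i)) (s≤s z≤n) i<r)) λ { (s≤s ()) }
    -- The overlap in `Z-rows` is the up-set of a cell of rank 1. Its correction `factor 0 w` is the
    -- difference between starting after `L` and after `R`, and cancels.
    go (suc n) refl = ⊕-cancelʳ (factor 0 w) (≈-trans
      (⊕-cong (≈-refl {factors 0 (suc M) (Z (suc (suc i)) 0)})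
        (factor-cong 0 (≈-sym (Z-pathSum n i≤r (cong suc (+-comm 1 i))
          (≤-trans b-diagonal (decreasing (suc i) (s≤s z≤n) i<r)) refl))))
      (≈-trans (factors-⊕-cong 0 (suc M) (Z-rows i))
        (≈-trans (⊕-cong (Z-wordSum i i≤r)
            (≈-trans (Z-pathSum M i<r (cong (suc ∘ suc) (sym (+-identityʳ i))) b-diagonal refl)
              (pathSum-L≈R⊕ n i (suc (suc i)) 0 b-diagonal)))
          λ k m → trans
            (sym (ℤₚ.+-assoc (wordSum (suc i) k m) (pathSum R M (suc i) (suc (suc i)) 0 k m) (factor 0 w k m)))
            (cong (_+ᶻ factor 0 w k m) (sym (wordSum-suc i k m))))))
      where w = pathSum L n i (suc (suc i)) 1

  factors-zetaSeries : factors 0 (suc M) (zetaSeries (ferrersPoset S)) ≈ wordSum r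
  factors-zetaSeries = go r r≥1 ≤-refl λ { (cell _ _ (_ , p , _)) → p , z≤n }
    where
    -- The row bound is separated from the parameter `r` in order to match it as a successor.
    go : ∀ r′ → 1 ≤ r′ → r′ ≤ r → (∀ y → Corner r′ 0 y) →
         factors 0 (suc M) (zetaSeries (ferrersPoset S)) ≈ wordSum r′
    go (suc i) _ i<r all =
      ≈-trans (factors-cong 0 (suc M) (chainSum-full (corner? (suc i) 0) all)) (Z-wordSum i i<r)

  maxRank≡M : FiniteGradedPoset.maxRank (ferrersPoset S) ≡ M
  maxRank≡M = ≤-antisym
    (max≤v⁺ {xs = map rankᶜ (cells {r} {b})} z≤n
      (Allₚ.map⁺ {xs = cells {r} {b}} {f = rankᶜ} (All.tabulate λ {x} _ → rank≤M x)))
    (v≤max⁺ 0 (map rankᶜ (cells {r} {b}))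
      (inj₂ (Any.map (λ { refl → ≤-reflexive (cong (_∸ 1) (sym b₁≡1+M)) })
        (∈-map⁺ rankᶜ (cells-complete (topᶜ S))))))
    where
    rank≤M : ∀ x → rankᶜ x ≤ M
    rank≤M x with topᶜ-max S x
    ... | 1≤row , col≤b = ≤-trans (∸-mono col≤b 1≤row) (≤-reflexive (cong (_∸ 1) b₁≡1+M))

-- The cleared denominator yields the word polynomial

wordPolynomial-monomials : ∀ r b → wordPolynomial r b ≈
  λ k m → ∑ (vectors letters (b 1 ∸ 1)) λ w → 𝟙 (inW? r b w) *ᶻ monomial R 0 w k m
wordPolynomial-monomials r b k m = trans (∑-filter (inW? r b) (vectors letters (b 1 ∸ 1)) _)
  (∑-cong (vectors letters (b 1 ∸ 1)) λ w → cong (𝟙 (inW? r b w) *ᶻ_)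
    (cong₂ (λ s n → (q^ s t^ n) k m) (sum-D w) (length-D w)))

numerator≈wordPolynomial : ∀ {r b} (S : IsShape r b) → let P = ferrersPoset S in
  ∏ (map 1-q^_t (upTo (suc (FiniteGradedPoset.maxRank P)))) ⊛ zetaSeries P ≈ wordPolynomial r b
numerator≈wordPolynomial {r} {b} S = ≈-trans
  (∏-⊛ 0 (suc maxRank) id (λ _ → refl) (zetaSeries (ferrersPoset S)))
  -- The product runs up to `maxRank`, the words have length `b 1 ∸ 1`; `maxRank≡M` identifies the
  -- two.
  (≈-trans (subst (λ H → factors 0 (suc H) (zetaSeries (ferrersPoset S)) ≈ F.wordSum r) (sym F.maxRank≡M)
             F.factors-zetaSeries)
           (≈-sym (wordPolynomial-monomials r b)))
  where
  open IsShape S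
  open FiniteGradedPoset (ferrersPoset S) using (maxRank)
  module F = Ferrers S (b 1 ∸ 1) (sym (m+[n∸m]≡n (diagonal 1 ≤-refl r≥1)))

-- Finite support and natural coefficients

δ-> : ∀ {a k} → a < k → δ a k ≡ 0ℤ
δ-> {a} {k} a<k = 𝟙-no (a ≟ k) (<⇒≢ a<k)

∑-monomials-polynomial : ∀ (xs : List X) (s n : X → ℕ) →
                         IsPolynomial (λ k m → ∑ xs λ x → (q^ s x t^ n x) k m)
∑-monomials-polynomial []       s n = 0 , λ _ _ _ → refl
∑-monomials-polynomial (x ∷ xs) s n with ∑-monomials-polynomial xs s n
-- This bound exceeds both exponents of the new monomial and is at least the earlier bound.
... | N , vanish = suc (s x + n x + N) , λ k m large →
    cong₂ _+ᶻ_ (head k m large) (vanish k m (Sum.map tail tail large))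
  where
  tail : ∀ {k} → suc (s x + n x + N) ≤ k → N ≤ k
  tail = ≤-trans (m≤n⇒m≤1+n (m≤n+m N (s x + n x)))
  head : ∀ k m → suc (s x + n x + N) ≤ k ⊎ suc (s x + n x + N) ≤ m → (q^ s x t^ n x) k m ≡ 0ℤ
  head k m (inj₁ large) = cong (_*ᶻ δ (n x) m)
    (δ-> (≤-trans (s≤s (≤-trans (m≤m+n (s x) (n x)) (m≤m+n _ N))) large))
  head k m (inj₂ large) = trans (cong (δ (s x) k *ᶻ_)
    (δ-> (≤-trans (s≤s (≤-trans (m≤n+m (n x) (s x)) (m≤m+n _ N))) large))) (ℤₚ.*-zeroʳ (δ (s x) k))

∑-monomials-natural : ∀ (xs : List X) (s n : X → ℕ) →
                      HasNaturalCoefficients (λ k m → ∑ xs λ x → (q^ s x t^ n x) k m)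
∑-monomials-natural []       s n k m = 0 , refl
∑-monomials-natural (x ∷ xs) s n k m with ∑-monomials-natural xs s n k m
... | j , eq = i + j , cong₂ _+ᶻ_ x-natural eq
  where
  i = (if does (s x ≟ k) then 1 else 0) * (if does (n x ≟ m) then 1 else 0)
  x-natural : (q^ s x t^ n x) k m ≡ ℤ.+ i
  x-natural with does (s x ≟ k) | does (n x ≟ m)
  ... | true  | true  = refl
  ... | true  | false = refl
  ... | false | _     = refl

-- Trapezoids as Ferrers shapes

module _ {r s : ℕ} (1≤r : 1 ≤ r) (r+r≤s : r + r ≤ s) where

  trapezoid-isShape : IsShape r (λ i → s ∸ i)
  trapezoid-isShape = record
    { r≥1        = 1≤r
    ; decreasing = λ i _ _ → ∸-monoʳ-≤ s (n≤1+n i)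
    ; diagonal   = λ i _ i≤r → m+n≤o⇒m≤o∸n i (≤-trans (+-mono-≤ i≤r i≤r) r+r≤s)
    }

  trapezoid-sameCells : SameCells (TrapezoidRegion r s) (FerrersRegion r (λ i → s ∸ i))
  trapezoid-sameCells = record
    { bijection      = mk↔ₛ′ to from (λ _ → cell-≡ refl refl) from∘to
    ; preserves-row  = λ _ → refl
    ; preserves-col  = λ _ → refl
    ; preserves-⊑    = λ _ _ → mk⇔ id id
    ; preserves-rank = λ _ → refl
    }
    where
    to : Cell (TrapezoidRegion r s) → FerrersCell r (λ i → s ∸ i)
    to (cell i c (p₁ , p₂ , p₃ , p₄)) = cell i c (p₁ , p₂ , p₃ , m+n≤o⇒m≤o∸n c p₄)
    from : FerrersCell r (λ i → s ∸ i) → Cell (TrapezoidRegion r s)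
    from (cell i c (p₁ , p₂ , p₃ , p₄)) =
      -- Truncated subtraction is undone using `i ≤ s`, which holds because `i ≤ r` and `r + r ≤ s`.
      cell i c (p₁ , p₂ , p₃ , m≤o∸n⇒m+n≤o c (≤-trans p₂ (m+n≤o⇒m≤o r r+r≤s)) p₄)
    from∘to : ∀ x → from (to x) ≡ x
    from∘to (cell i c (p₁ , p₂ , p₃ , p₄)) =
      cong (λ p → cell i c (p₁ , p₂ , p₃ , p)) (≤-irrelevant _ p₄)

theorem5p1 : (∀ (r : ℕ) (b : ℕ → ℕ) (S : IsShape r b) →
    (∀ h → IsNumerator (ferrersPoset S) h ⇔ h ≈ wordPolynomial r b)
    × (∀ h → IsNumerator (ferrersPoset S) h → HasNaturalCoefficients h))
    × (∀ (r s : ℕ) → 2 ≤ 2 * r → 2 * r ≤ s →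
    IsShape r (λ i → s ∸ i)
    × SameCells (TrapezoidRegion r s) (FerrersRegion r (λ i → s ∸ i)))
theorem5p1 = ferrers , trapezoid
  where
  ferrers : ∀ r b (S : IsShape r b) →
    (∀ h → IsNumerator (ferrersPoset S) h ⇔ h ≈ wordPolynomial r b)
    × (∀ h → IsNumerator (ferrersPoset S) h → HasNaturalCoefficients h)
  ferrers r b S =
    (λ h → mk⇔ (λ (_ , eq) → ≈-trans eq W)
               (λ eq → polynomial eq , ≈-trans eq (≈-sym W))) ,
    λ h (_ , eq) k m → Product.map₂ (trans (≈-trans eq W k m))
      (∑-monomials-natural (𝒲 r b) (λ w → sum (map toℕ (D w))) (λ w → length (D w)) k m)
    where
    W = numerator≈wordPolynomial S
    polynomial : ∀ {h} → h ≈ wordPolynomial r b → IsPolynomial h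
    polynomial eq with ∑-monomials-polynomial (𝒲 r b) (λ w → sum (map toℕ (D w))) (λ w → length (D w))
    ... | N , vanish = N , λ k m large → trans (eq k m) (vanish k m large)

  trapezoid : ∀ r s → 2 ≤ 2 * r → 2 * r ≤ s →
    IsShape r (λ i → s ∸ i) × SameCells (TrapezoidRegion r s) (FerrersRegion r (λ i → s ∸ i))
  trapezoid r s 2≤2r 2r≤s = trapezoid-isShape 1≤r r+r≤s , trapezoid-sameCells 1≤r r+r≤s
    where
    1≤r : 1 ≤ r
    1≤r = *-cancelˡ-≤ 2 2≤2r
    r+r≤s : r + r ≤ s
    r+r≤s = subst (λ n → r + n ≤ s) (+-identityʳ r) 2r≤s
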